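{- Let $R$ be a finite valuation ring with residue field of odd size $q$ and with uniformizer of nilpotency degree $\ell$, and let $n\geq 2$. For non-empty $A,B\subseteq R^n$ let $N_1(A,B)=|\{(a,b)\in A\times B: a\cdot b=1\}|$, where $a\cdot b=\sum_i a_ib_i$. Then \[ \big|N_1(A,B)-q^{ -\ell}|A||B|\big|<q^{(n-1)(\ell-1/2)}\sqrt{|A||B|}. \] In particular, $1\in A\cdot B=\{a\cdot b:a\in A,b\in B\}$ whenever $\delta(A)\,\delta(B)\geq q^{ -(n-1)}$, where $\delta(A)=|A|/|R^n|$.
   Context: Rings are commutative with identity. A finite valuation ring is a finite local principal ring; its maximal ideal is $(\pi)$, $q=|R/(\pi)|$, and $\ell$ is the smallest positive integer with $\pi^\ell=0$. -}

module Defs where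

open import Data.Nat using (ℕ; zero; suc; _+_; _*_; _≤_; _<_)
open import Data.Fin using (Fin; _≟_)
open import Data.Fin.Base using () renaming (zero to fzero)
open import Data.List using (List; []; _∷_; map; concatMap; allFin; cartesianProduct)
open import Data.Vec using (Vec; []; _∷_)
open import Data.Bool using (Bool; true; false; _∧_; if_then_else_)
open import Data.Product using (Σ; ∃; _×_; _,_)
open import Relation.Binary.PropositionalEquality using (_≡_)
open import Relation.Nullary using (¬_)
open import Relation.Nullary.Decidable using (⌊_⌋)
open import Algebra.Structures using (IsCommutativeRing)
open import Function.Bundles using (_⇔_)
open import Data.Sum using (_⊎_)

record FinCommRing (m : ℕ) : Set where
  infixl 6 _+ᴿ_
  infixl 7 _*ᴿ_
  field
    _+ᴿ_ _*ᴿ_ : Fin m → Fin m → Fin m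
    -ᴿ_ : Fin m → Fin m
    0ᴿ 1ᴿ : Fin m
    isCommutativeRing : IsCommutativeRing _≡_ _+ᴿ_ _*ᴿ_ -ᴿ_ 0ᴿ 1ᴿ

module _ {m : ℕ} (R : FinCommRing m) where
  open FinCommRing R

  record IsIdeal (I : Fin m → Set) : Set where
    field
      zero-mem : I 0ᴿ
      +-closed : ∀ x y → I x → I y → I (x +ᴿ y)
      *-closed : ∀ r x → I x → I (r *ᴿ x)

  ⟨_⟩ : Fin m → Fin m → Set
  ⟨ g ⟩ x = ∃ λ r → x ≡ r *ᴿ g

  IsMaximalIdeal : (Fin m → Set) → Set₁
  IsMaximalIdeal M =
    IsIdeal M × ¬ M 1ᴿ ×
    ((J : Fin m → Set) → IsIdeal J → (∀ x → M x → J x) →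
       (∀ x → J x → M x) ⊎ (∀ x → J x))

  IsLocal : Set₁
  IsLocal = Σ (Fin m → Set) λ M → IsMaximalIdeal M ×
              ((J : Fin m → Set) → IsMaximalIdeal J → ∀ x → (J x ⇔ M x))

  IsPrincipalRing : Set₁
  IsPrincipalRing = (I : Fin m → Set) → IsIdeal I →
                    ∃ λ g → ∀ x → (I x ⇔ ⟨ g ⟩ x)

  -- |R/(π)| = q : a complete, irredundant system of q representatives mod (π)
  ResidueCard : Fin m → ℕ → Set
  ResidueCard π q = Σ (Fin q → Fin m) λ rep →
    (∀ i j → ⟨ π ⟩ (rep i +ᴿ (-ᴿ rep j)) → i ≡ j) ×
    (∀ x → ∃ λ i → ⟨ π ⟩ (x +ᴿ (-ᴿ rep i)))

  pow : Fin m → ℕ → Fin m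
  pow x zero = 1ᴿ
  pow x (suc k) = x *ᴿ pow x k

  NilDegree : Fin m → ℕ → Set
  NilDegree π ℓ = 1 ≤ ℓ × pow π ℓ ≡ 0ᴿ × (∀ k → 1 ≤ k → k < ℓ → ¬ pow π k ≡ 0ᴿ)

  dot : ∀ {n} → Vec (Fin m) n → Vec (Fin m) n → Fin m
  dot [] [] = 0ᴿ
  dot (x ∷ xs) (y ∷ ys) = x *ᴿ y +ᴿ dot xs ys

allVecs : ∀ {m} n → List (Vec (Fin m) n)
allVecs zero = [] ∷ []
allVecs {m} (suc n) = concatMap (λ x → map (x ∷_) (allVecs n)) (allFin m)

count : ∀ {X : Set} → (X → Bool) → List X → ℕ
count p [] = 0
count p (x ∷ xs) = (if p x then 1 else 0) + count p xs

card : ∀ {m n} → (Vec (Fin m) n → Bool) → ℕ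
card {n = n} A = count A (allVecs n)

N₁ : ∀ {m n} (R : FinCommRing m) → (A B : Vec (Fin m) n → Bool) → ℕ
N₁ {n = n} R A B =
  count (λ { (a , b) → A a ∧ B b ∧ ⌊ dot R a b ≟ FinCommRing.1ᴿ R ⌋ })
        (cartesianProduct (allVecs n) (allVecs n))

NonEmpty : ∀ {m n} → (Vec (Fin m) n → Bool) → Set
NonEmpty A = ∃ λ a → A a ≡ true

{-# OPTIONS --safe #-}
-- Let f(b) = #{a ∈ A : a·b = 1} and M = |R| = q^ℓ.  By Cauchy–Schwarz the squared error
-- (M N₁ − |A||B|)² is at most |B| V, where V = Σ_b (M f(b) − |A|)² runs over all of Rⁿ.
-- Expanding V needs only the sizes of {b : a·b = 1} and {b : a·b = a′·b = 1}.  The first is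
-- M^{n−1} if a is primitive (has an invertible coordinate) and 0 otherwise.  If a is primitive
-- and a′ = a + π^k w with w primitive, the second is at most M^{n−2} q^k: eliminating one
-- coordinate leaves one primitive linear equation modulo the annihilator of π^k, or none
-- solvable when w is proportional to a modulo π.  With α primitive and z non-primitive
-- vectors in A this yields V ≤ Mⁿ (z² + α T), where T = Σ_{1≤k≤ℓ} (q^k − q^{k−1}) |π^k R|ⁿ;
-- both T and z ≤ |πR|ⁿ are smaller than q^{(ℓ−1)n+1}, whence the strict bound.
module Submission where

open import Defs
open import Data.Nat using (ℕ; zero; suc; _+_; _*_; _∸_; _^_; _≤_; _<_; z≤n; s≤s; s≤s⁻¹; ∣_-_∣; _%_; NonZero; >-nonZero)
open import Data.Nat.Properties hiding (_≟_; suc-injective)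
open import Data.Nat.Tactic.RingSolver using (solve-∀)
open import Data.Fin using (Fin; _≟_; punchOut) renaming (zero to fzero; suc to fsuc)
open import Data.Fin.Properties using (any?; all?; suc-injective)
open import Data.Vec using (Vec; []; _∷_; lookup; insertAt; removeAt; zipWith; replicate)
open import Data.Vec.Properties using (removeAt-punchOut; lookup-zipWith; lookup-replicate)
open import Data.List using (List; []; _∷_; _++_; map; concatMap; allFin; cartesianProduct)
open import Data.List.Properties using (map-tabulate)
open import Data.Bool using (Bool; true; false; _∧_; if_then_else_)
open import Data.Product using (∃; _×_; _,_; proj₁; proj₂)
open import Data.Sum using (_⊎_; inj₁; inj₂)
open import Data.Empty using (⊥-elim)
open import Function using (_∘_; id)
open import Level using (0ℓ)
open import Relation.Nullary using (¬_; Dec; yes; no)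
open import Relation.Nullary.Decidable using (⌊_⌋)
open import Relation.Binary.PropositionalEquality using (_≡_; _≢_; refl; sym; trans; cong; cong₂; subst; module ≡-Reasoning)
open import Algebra.Bundles using (CommutativeRing)

-- Everything stays in the natural numbers: the error is multiplied by q^ℓ and squared, which clears
-- the square root and the division by q^ℓ, and the negative cross term of V is carried on the other
-- side. That cross term must be known exactly, hence an exact size for {b : a·b = 1}. The second
-- moment of f enters V with a positive sign, so for pairs an upper bound is enough. The main terms
-- then cancel by α² + (α + z)² - 2α(α + z) = z².
--
-- T comes from writing q^k = 1 + Σ_{1≤j≤k} (q^j - q^{j-1}). The summand 1 produces the main term
-- α²; the j-th summand is charged to every a′ congruent to a modulo π^j, at most |π^j R|ⁿ of them,
-- so no count at an exact level k is required.
--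
-- The constant is Mⁿ q^{(ℓ-1)n+1} = q^{(n-1)(2ℓ-1)+2ℓ}. If N₁ were 0, the bound would give |A||B| <
-- q^{(n-1)(2ℓ-1)+2ℓ}, and a factor q^{n-1} turns the right side into M^{2n}; this is the second
-- claim.

-- Finite sums over lists.

∑ : {X : Set} → List X → (X → ℕ) → ℕ
∑ []       f = 0
∑ (x ∷ xs) f = f x + ∑ xs f

syntax ∑ xs (λ x → e) = ∑[ x ∈ xs ] e

module _ {X : Set} where

  ∑-cong : ∀ (xs : List X) {f g} → (∀ x → f x ≡ g x) → ∑ xs f ≡ ∑ xs g
  ∑-cong []       eq = refl
  ∑-cong (x ∷ xs) eq = cong₂ _+_ (eq x) (∑-cong xs eq)

  ∑-mono : ∀ (xs : List X) {f g} → (∀ x → f x ≤ g x) → ∑ xs f ≤ ∑ xs g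
  ∑-mono []       le = z≤n
  ∑-mono (x ∷ xs) le = +-mono-≤ (le x) (∑-mono xs le)

  ∑-zero : ∀ (xs : List X) {f} → (∀ x → f x ≡ 0) → ∑ xs f ≡ 0
  ∑-zero []       eq = refl
  ∑-zero (x ∷ xs) eq = cong₂ _+_ (eq x) (∑-zero xs eq)

  ∑-+ : ∀ (xs : List X) f g → ∑[ x ∈ xs ] (f x + g x) ≡ ∑ xs f + ∑ xs g
  ∑-+ []       f g = refl
  ∑-+ (x ∷ xs) f g rewrite ∑-+ xs f g = interchange (f x) (g x) (∑ xs f) (∑ xs g)
    where
    interchange : ∀ a b c d → a + b + (c + d) ≡ a + c + (b + d)
    interchange = solve-∀

  ∑-*ˡ : ∀ (xs : List X) c f → ∑[ x ∈ xs ] (c * f x) ≡ c * ∑ xs f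
  ∑-*ˡ []       c f = sym (*-zeroʳ c)
  ∑-*ˡ (x ∷ xs) c f rewrite ∑-*ˡ xs c f = sym (*-distribˡ-+ c (f x) (∑ xs f))

  ∑-*ʳ : ∀ (xs : List X) f c → ∑[ x ∈ xs ] (f x * c) ≡ ∑ xs f * c
  ∑-*ʳ xs f c = trans (∑-cong xs (λ x → *-comm (f x) c)) (trans (∑-*ˡ xs c f) (*-comm c _))

  ∑-++ : ∀ (xs ys : List X) f → ∑ (xs ++ ys) f ≡ ∑ xs f + ∑ ys f
  ∑-++ []       ys f = refl
  ∑-++ (x ∷ xs) ys f rewrite ∑-++ xs ys f = sym (+-assoc (f x) (∑ xs f) (∑ ys f))

  ∑-∣-∣ : ∀ (xs : List X) f g → ∣ ∑ xs f - ∑ xs g ∣ ≤ ∑[ x ∈ xs ] ∣ f x - g x ∣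
  ∑-∣-∣ []       f g = z≤n
  ∑-∣-∣ (x ∷ xs) f g = begin
    ∣ f x + ∑ xs f - g x + ∑ xs g ∣                                ≤⟨ ∣-∣-triangle (f x + ∑ xs f) (g x + ∑ xs f) (g x + ∑ xs g) ⟩
    ∣ f x + ∑ xs f - g x + ∑ xs f ∣ + ∣ g x + ∑ xs f - g x + ∑ xs g ∣
      ≡⟨ cong₂ _+_ (cong₂ ∣_-_∣ (+-comm (f x) _) (+-comm (g x) _)) refl ⟩
    ∣ ∑ xs f + f x - ∑ xs f + g x ∣ + ∣ g x + ∑ xs f - g x + ∑ xs g ∣
      ≡⟨ cong₂ _+_ (∣m+n-m+o∣≡∣n-o∣ (∑ xs f) _ _) (∣m+n-m+o∣≡∣n-o∣ (g x) _ _) ⟩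
    ∣ f x - g x ∣ + ∣ ∑ xs f - ∑ xs g ∣                            ≤⟨ +-monoʳ-≤ ∣ f x - g x ∣ (∑-∣-∣ xs f g) ⟩
    ∣ f x - g x ∣ + ∑[ x ∈ xs ] ∣ f x - g x ∣                      ∎
    where open ≤-Reasoning

module _ {X Y : Set} where

  ∑-swap : ∀ (xs : List X) (ys : List Y) (f : X → Y → ℕ) →
           ∑[ x ∈ xs ] ∑[ y ∈ ys ] f x y ≡ ∑[ y ∈ ys ] ∑[ x ∈ xs ] f x y
  ∑-swap []       ys f = sym (∑-zero ys (λ _ → refl))
  ∑-swap (x ∷ xs) ys f rewrite ∑-swap xs ys f = sym (∑-+ ys (f x) _)

  ∑-map : ∀ (g : Y → X) ys f → ∑ (map g ys) f ≡ ∑[ y ∈ ys ] f (g y)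
  ∑-map g []       f = refl
  ∑-map g (y ∷ ys) f = cong (f (g y) +_) (∑-map g ys f)

  ∑-concatMap : ∀ (g : Y → List X) ys f →
                ∑ (concatMap g ys) f ≡ ∑[ y ∈ ys ] ∑ (g y) f
  ∑-concatMap g []       f = refl
  ∑-concatMap g (y ∷ ys) f =
    trans (∑-++ (g y) (concatMap g ys) f) (cong (∑ (g y) f +_) (∑-concatMap g ys f))

∑-cartesianProduct : ∀ {X Y : Set} (xs : List X) (ys : List Y) f →
  ∑ (cartesianProduct xs ys) f ≡ ∑[ x ∈ xs ] ∑[ y ∈ ys ] f (x , y)
∑-cartesianProduct []       ys f = refl
∑-cartesianProduct (x ∷ xs) ys f =
  trans (∑-++ (map (x ,_) ys) (cartesianProduct xs ys) f)
        (cong₂ _+_ (∑-map (x ,_) ys f) (∑-cartesianProduct xs ys f))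

∑-*-∑ : ∀ {X Y : Set} (xs : List X) (ys : List Y) f g →
        ∑ xs f * ∑ ys g ≡ ∑[ x ∈ xs ] ∑[ y ∈ ys ] (f x * g y)
∑-*-∑ xs ys f g = trans (sym (∑-*ʳ xs f (∑ ys g))) (∑-cong xs (λ x → sym (∑-*ˡ ys (f x) g)))

∑-pos : ∀ {X : Set} (xs : List X) f → 0 < ∑ xs f → ∃ λ x → 0 < f x
∑-pos (x ∷ xs) f pos with f x in eq
... | suc _ = x , subst (0 <_) (sym eq) (s≤s z≤n)
... | zero  = ∑-pos xs f pos

-- Elementary inequalities and Cauchy-Schwarz in ℕ.

-- The expansion of (x - y)² with the cross term on the left, so that no truncated subtraction
-- occurs.
∣-∣²+2xy : ∀ x y → ∣ x - y ∣ * ∣ x - y ∣ + 2 * (x * y) ≡ x * x + y * y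
∣-∣²+2xy zero    y       = +-identityʳ (y * y)
∣-∣²+2xy (suc x) zero    rewrite *-zeroʳ x = refl
∣-∣²+2xy (suc x) (suc y) = begin
  ∣ x - y ∣ * ∣ x - y ∣ + 2 * (suc x * suc y)             ≡⟨ shift (∣ x - y ∣ * ∣ x - y ∣) x y ⟩
  ∣ x - y ∣ * ∣ x - y ∣ + 2 * (x * y) + 2 * (1 + x + y)   ≡⟨ cong (_+ 2 * (1 + x + y)) (∣-∣²+2xy x y) ⟩
  x * x + y * y + 2 * (1 + x + y)                         ≡⟨ square x y ⟩
  suc x * suc x + suc y * suc y                           ∎
  where
  open ≡-Reasoning
  shift : ∀ d x y → d + 2 * (suc x * suc y) ≡ d + 2 * (x * y) + 2 * (1 + x + y)
  shift = solve-∀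
  square : ∀ x y → x * x + y * y + 2 * (1 + x + y) ≡ suc x * suc x + suc y * suc y
  square = solve-∀

2xy≤x²+y² : ∀ x y → 2 * (x * y) ≤ x * x + y * y
2xy≤x²+y² x y = subst (2 * (x * y) ≤_) (∣-∣²+2xy x y) (m≤n+m _ (∣ x - y ∣ * ∣ x - y ∣))

-- Both z² ≤ Kz and αT ≤ Kα hold, but either can be an equality 0 = 0. Since α + z > 0, one of them
-- is strict; the cases α = 0 and α > 0 decide which.
combination< : ∀ {T K} α z → z < K → T < K → 0 < α + z → z * z + α * T < K * (α + z)
combination< {T} {K} zero (suc z) z<K T<K _ = begin-strict
  suc z * suc z + 0     ≡⟨ +-identityʳ _ ⟩
  suc z * suc z         <⟨ *-monoˡ-< (suc z) z<K ⟩
  K * suc z             ∎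
  where open ≤-Reasoning
combination< {T} {K} (suc α) z z<K T<K _ = begin-strict
  z * z + suc α * T     <⟨ +-mono-≤-< (*-monoˡ-≤ z (<⇒≤ z<K)) (*-monoʳ-< (suc α) T<K) ⟩
  K * z + suc α * K     ≡⟨ arrange K z (suc α) ⟩
  K * (suc α + z)       ∎
  where
  open ≤-Reasoning
  arrange : ∀ K z α → K * z + α * K ≡ K * (α + z)
  arrange = solve-∀

module _ {X : Set} (w h : X → ℕ) where

  -- 2 a h(x) ≤ a² + h(x)², averaged with weights w.
  2a∑≤ : ∀ a xs → 2 * (a * ∑[ x ∈ xs ] (w x * h x)) ≤ a * a * ∑ xs w + ∑[ x ∈ xs ] (w x * (h x * h x))
  2a∑≤ a []       rewrite *-zeroʳ a = z≤n
  2a∑≤ a (x ∷ xs) = begin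
    2 * (a * (w x * h x + S))                         ≡⟨ lhs a (w x) (h x) S ⟩
    w x * (2 * (a * h x)) + 2 * (a * S)               ≤⟨ +-mono-≤ (*-monoʳ-≤ (w x) (2xy≤x²+y² a (h x))) (2a∑≤ a xs) ⟩
    w x * (a * a + h x * h x) + (a * a * W + T)       ≡⟨ rhs a (w x) (h x) W T ⟩
    a * a * (w x + W) + (w x * (h x * h x) + T)       ∎
    where
    open ≤-Reasoning
    S = ∑[ x ∈ xs ] (w x * h x)
    W = ∑ xs w
    T = ∑[ x ∈ xs ] (w x * (h x * h x))
    lhs : ∀ a w h S → 2 * (a * (w * h + S)) ≡ w * (2 * (a * h)) + 2 * (a * S)
    lhs = solve-∀
    rhs : ∀ a w h W T → w * (a * a + h * h) + (a * a * W + T) ≡ a * a * (w + W) + (w * (h * h) + T)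
    rhs = solve-∀

  -- Induction on the list: the mixed term 2 (w x)(h x) S of the expanded square is absorbed by
  -- `2a∑≤` at a = h x.
  cauchySchwarz : ∀ xs → let S = ∑[ x ∈ xs ] (w x * h x) in
                  S * S ≤ ∑ xs w * ∑[ x ∈ xs ] (w x * (h x * h x))
  cauchySchwarz []       = z≤n
  cauchySchwarz (x ∷ xs) = begin
    (w x * h x + S) * (w x * h x + S)                         ≡⟨ lhs (w x) (h x) S ⟩
    w x * w x * (h x * h x) + w x * (2 * (h x * S)) + S * S
      ≤⟨ +-mono-≤ (+-monoʳ-≤ (w x * w x * (h x * h x)) (*-monoʳ-≤ (w x) (2a∑≤ (h x) xs))) (cauchySchwarz xs) ⟩
    w x * w x * (h x * h x) + w x * (h x * h x * W + T) + W * T ≡⟨ rhs (w x) (h x) W T ⟩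
    (w x + W) * (w x * (h x * h x) + T)                       ∎
    where
    open ≤-Reasoning
    S = ∑[ x ∈ xs ] (w x * h x)
    W = ∑ xs w
    T = ∑[ x ∈ xs ] (w x * (h x * h x))
    lhs : ∀ w h S → (w * h + S) * (w * h + S) ≡ w * w * (h * h) + w * (2 * (h * S)) + S * S
    lhs = solve-∀
    rhs : ∀ w h W T → w * w * (h * h) + w * (h * h * W + T) + W * T ≡ (w + W) * (w * (h * h) + T)
    rhs = solve-∀

-- Indicator functions.

𝟙 : Bool → ℕ
𝟙 b = if b then 1 else 0

-- Iverson bracket taken on the decision rather than on its Boolean, so that a case split hands over
-- the proof or the refutation.
iv : {P : Set} → Dec P → ℕ
iv (yes _) = 1
iv (no _)  = 0

module _ {P : Set} where

  iv-yes : (d : Dec P) → P → iv d ≡ 1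
  iv-yes (yes _) p = refl
  iv-yes (no ¬p) p = ⊥-elim (¬p p)

  iv-no : (d : Dec P) → ¬ P → iv d ≡ 0
  iv-no (yes p) ¬p = ⊥-elim (¬p p)
  iv-no (no _)  ¬p = refl

  iv≤1 : (d : Dec P) → iv d ≤ 1
  iv≤1 (yes _) = s≤s z≤n
  iv≤1 (no _)  = z≤n

  𝟙⌊⌋ : (d : Dec P) → 𝟙 ⌊ d ⌋ ≡ iv d
  𝟙⌊⌋ (yes _) = refl
  𝟙⌊⌋ (no _)  = refl

module _ {P Q : Set} where

  iv-cong : (d : Dec P) (e : Dec Q) → (P → Q) → (Q → P) → iv d ≡ iv e
  iv-cong (yes p) e f g = sym (iv-yes e (f p))
  iv-cong (no ¬p) e f g = sym (iv-no e (¬p ∘ g))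

  iv-mono : (d : Dec P) (e : Dec Q) → (P → Q) → iv d ≤ iv e
  iv-mono (yes p) e f = ≤-reflexive (sym (iv-yes e (f p)))
  iv-mono (no ¬p) e f = z≤n

module _ {P Q Q′ : Set} where

  -- The first indicator acts as a hypothesis: an equation already imposed may be used to rewrite
  -- the next one.
  iv-*-mono : (d : Dec P) (e : Dec Q) (e′ : Dec Q′) → (P → Q → Q′) → iv d * iv e ≤ iv d * iv e′
  iv-*-mono (yes p) e e′ f = *-monoʳ-≤ 1 (iv-mono e e′ (f p))
  iv-*-mono (no ¬p) e e′ f = z≤n

𝟙≤1 : ∀ b → 𝟙 b ≤ 1
𝟙≤1 true  = s≤s z≤n
𝟙≤1 false = z≤n

𝟙-∧ : ∀ b c → 𝟙 (b ∧ c) ≡ 𝟙 b * 𝟙 c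
𝟙-∧ true  c = sym (+-identityʳ (𝟙 c))
𝟙-∧ false c = refl

count≡∑ : ∀ {X : Set} (p : X → Bool) xs → count p xs ≡ ∑[ x ∈ xs ] 𝟙 (p x)
count≡∑ p []       = refl
count≡∑ p (x ∷ xs) = cong (𝟙 (p x) +_) (count≡∑ p xs)

-- Sums over `Fin n` and over vectors.

∑-allFin-suc : ∀ n (f : Fin (suc n) → ℕ) →
               ∑ (allFin (suc n)) f ≡ f fzero + ∑[ i ∈ allFin n ] f (fsuc i)
∑-allFin-suc n f = cong (f fzero +_) (trans (cong (λ xs → ∑ xs f) (sym (map-tabulate id fsuc)))
                                            (∑-map fsuc (allFin n) f))

∑-1-allFin : ∀ n → ∑[ _ ∈ allFin n ] 1 ≡ n
∑-1-allFin zero    = refl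
∑-1-allFin (suc n) = trans (∑-allFin-suc n (λ _ → 1)) (cong suc (∑-1-allFin n))

-- Read forwards it evaluates a sum at the only root of an equation; read backwards it inserts a
-- dummy variable, after which the order of summation can be exchanged.
∑-unique : ∀ {n} {P : Fin n → Set} (P? : ∀ i → Dec (P i)) (f : Fin n → ℕ) j →
           P j → (∀ i → P i → i ≡ j) → ∑[ i ∈ allFin n ] (iv (P? i) * f i) ≡ f j
∑-unique {suc n} P? f fzero pj uniq = begin
  ∑ (allFin (suc n)) _                                             ≡⟨ ∑-allFin-suc n _ ⟩
  iv (P? fzero) * f fzero + ∑[ i ∈ allFin n ] (iv (P? (fsuc i)) * f (fsuc i))
    ≡⟨ cong₂ _+_ (cong (_* f fzero) (iv-yes (P? fzero) pj))
                 (∑-zero (allFin n) (λ i → cong (_* f (fsuc i)) (iv-no (P? (fsuc i)) (λ p → 0≢suc (uniq _ p))))) ⟩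
  1 * f fzero + 0                                                  ≡⟨ trans (+-identityʳ _) (*-identityˡ (f fzero)) ⟩
  f fzero                                                          ∎
  where
  open ≡-Reasoning
  0≢suc : ∀ {i : Fin n} → ¬ fsuc i ≡ fzero
  0≢suc ()
∑-unique {suc n} P? f (fsuc j) pj uniq = begin
  ∑ (allFin (suc n)) _                                             ≡⟨ ∑-allFin-suc n _ ⟩
  iv (P? fzero) * f fzero + ∑[ i ∈ allFin n ] (iv (P? (fsuc i)) * f (fsuc i))
    ≡⟨ cong₂ _+_ (cong (_* f fzero) (iv-no (P? fzero) (λ p → 0≢suc (uniq _ p))))
                 (∑-unique (P? ∘ fsuc) (f ∘ fsuc) j pj (λ i p → suc-injective (uniq _ p))) ⟩
  f (fsuc j)                                                       ∎
  where
  open ≡-Reasoning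
  0≢suc : ∀ {i : Fin n} → ¬ fzero ≡ fsuc i
  0≢suc ()

∑-unique₁ : ∀ {n} {P : Fin n → Set} (P? : ∀ i → Dec (P i)) j →
            P j → (∀ i → P i → i ≡ j) → ∑[ i ∈ allFin n ] iv (P? i) ≡ 1
∑-unique₁ {n} P? j pj uniq =
  trans (∑-cong (allFin n) (λ i → sym (*-identityʳ (iv (P? i))))) (∑-unique P? (λ _ → 1) j pj uniq)

∑-reindex : ∀ {n} (φ ψ : Fin n → Fin n) → (∀ x → φ (ψ x) ≡ x) → (∀ x → ψ (φ x) ≡ x) →
            ∀ f → ∑[ x ∈ allFin n ] f (φ x) ≡ ∑ (allFin n) f
∑-reindex {n} φ ψ φψ ψφ f = begin
  ∑[ x ∈ allFin n ] f (φ x)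
    ≡⟨ ∑-cong (allFin n) (λ x → sym (∑-unique (λ y → y ≟ φ x) f (φ x) refl (λ _ p → p))) ⟩
  ∑[ x ∈ allFin n ] ∑[ y ∈ allFin n ] (iv (y ≟ φ x) * f y)
    ≡⟨ ∑-swap (allFin n) (allFin n) (λ x y → iv (y ≟ φ x) * f y) ⟩
  ∑[ y ∈ allFin n ] ∑[ x ∈ allFin n ] (iv (y ≟ φ x) * f y)
    ≡⟨ ∑-cong (allFin n) (λ y → trans (∑-*ʳ (allFin n) _ (f y))
         (trans (cong (_* f y) (∑-unique₁ (λ x → y ≟ φ x) (ψ y) (sym (φψ y))
                                 (λ x p → trans (sym (ψφ x)) (cong ψ (sym p)))))
                (*-identityˡ (f y)))) ⟩
  ∑ (allFin n) f ∎
  where open ≡-Reasoning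

module _ {m : ℕ} where

  ∑-allVecs-suc : ∀ n (f : Vec (Fin m) (suc n) → ℕ) →
    ∑ (allVecs (suc n)) f ≡ ∑[ x ∈ allFin m ] ∑[ v ∈ allVecs n ] f (x ∷ v)
  ∑-allVecs-suc n f = trans (∑-concatMap (λ x → map (x ∷_) (allVecs n)) (allFin m) f)
                            (∑-cong (allFin m) (λ x → ∑-map (x ∷_) (allVecs n) f))

  ∑-1-allVecs : ∀ n → ∑[ _ ∈ allVecs {m} n ] 1 ≡ m ^ n
  ∑-1-allVecs zero    = refl
  ∑-1-allVecs (suc n) = begin
    ∑[ _ ∈ allVecs {m} (suc n) ] 1               ≡⟨ ∑-allVecs-suc n _ ⟩
    ∑[ x ∈ allFin m ] ∑[ _ ∈ allVecs {m} n ] 1   ≡⟨ ∑-cong (allFin m) (λ _ → trans (∑-1-allVecs n) (sym (*-identityˡ (m ^ n)))) ⟩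
    ∑[ x ∈ allFin m ] (1 * m ^ n)                ≡⟨ ∑-*ʳ (allFin m) (λ _ → 1) (m ^ n) ⟩
    ∑[ x ∈ allFin m ] 1 * m ^ n                  ≡⟨ cong (_* m ^ n) (∑-1-allFin m) ⟩
    m * m ^ n                                    ∎
    where open ≡-Reasoning

  -- The invertible coordinate of a primitive vector can sit anywhere, so any chosen coordinate has
  -- to be available as the innermost summation variable.
  ∑-insertAt : ∀ n (i : Fin (suc n)) (f : Vec (Fin m) (suc n) → ℕ) →
    ∑ (allVecs (suc n)) f ≡ ∑[ v ∈ allVecs n ] ∑[ x ∈ allFin m ] f (insertAt v i x)
  ∑-insertAt n fzero f = trans (∑-allVecs-suc n f) (∑-swap (allFin m) (allVecs n) (λ x v → f (x ∷ v)))
  ∑-insertAt (suc n) (fsuc i) f = begin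
    ∑ (allVecs (suc (suc n))) f                                                           ≡⟨ ∑-allVecs-suc (suc n) f ⟩
    ∑[ y ∈ allFin m ] ∑[ v ∈ allVecs (suc n) ] f (y ∷ v)
      ≡⟨ ∑-cong (allFin m) (λ y → ∑-insertAt n i (λ v → f (y ∷ v))) ⟩
    ∑[ y ∈ allFin m ] ∑[ v ∈ allVecs n ] ∑[ x ∈ allFin m ] f (insertAt (y ∷ v) (fsuc i) x) ≡⟨ sym (∑-allVecs-suc n _) ⟩
    ∑[ v ∈ allVecs (suc n) ] ∑[ x ∈ allFin m ] f (insertAt v (fsuc i) x)                   ∎
    where open ≡-Reasoning

  -- This is completeness of the enumeration `allVecs`; it makes the cardinality of an inhabited set
  -- positive.
  ≤∑-allVecs : ∀ {n} (v : Vec (Fin m) n) (f : Vec (Fin m) n → ℕ) → f v ≤ ∑ (allVecs n) f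
  ≤∑-allVecs [] f = m≤m+n (f []) 0
  ≤∑-allVecs {suc n} (x ∷ v) f = begin
    f (x ∷ v)                                              ≤⟨ ≤∑-allVecs v (λ v → f (x ∷ v)) ⟩
    ∑[ v ∈ allVecs n ] f (x ∷ v)
      ≡⟨ sym (∑-unique (_≟ x) (λ x → ∑[ v ∈ allVecs n ] f (x ∷ v)) x refl (λ _ p → p)) ⟩
    ∑[ y ∈ allFin m ] (iv (y ≟ x) * ∑[ v ∈ allVecs n ] f (y ∷ v))
      ≤⟨ ∑-mono (allFin m) (λ y → ≤-trans (*-monoˡ-≤ _ (iv≤1 (y ≟ x))) (≤-reflexive (*-identityˡ _))) ⟩
    ∑[ y ∈ allFin m ] ∑[ v ∈ allVecs n ] f (y ∷ v)         ≡⟨ sym (∑-allVecs-suc n f) ⟩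
    ∑ (allVecs (suc n)) f                                  ∎
    where open ≤-Reasoning

-- Linear equations over a finite commutative ring.

module FiniteRing {m : ℕ} (R : FinCommRing m) where

  open FinCommRing R

  commutativeRing : CommutativeRing 0ℓ 0ℓ
  commutativeRing = record { isCommutativeRing = isCommutativeRing }

  module K = CommutativeRing commutativeRing

  open import Algebra.Properties.Group K.+-group using () renaming (∙-cancelˡ to +ᴿ-cancelˡ)
  open import Algebra.Properties.Ring K.ring using (-‿distribˡ-*; -‿distribʳ-*; -‿involutive)
  open import Algebra.Solver.Ring.NaturalCoefficients.Default K.commutativeSemiring
    using (solve; _:=_; _:+_; _:*_; con)

  x+y-y≡x : ∀ x y → (x +ᴿ y) +ᴿ (-ᴿ y) ≡ x
  x+y-y≡x x y = trans (K.+-assoc x y (-ᴿ y)) (trans (cong (x +ᴿ_) (K.-‿inverseʳ y)) (K.+-identityʳ x))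

  x-y+y≡x : ∀ x y → (x +ᴿ (-ᴿ y)) +ᴿ y ≡ x
  x-y+y≡x x y = trans (K.+-assoc x (-ᴿ y) y) (trans (cong (x +ᴿ_) (K.-‿inverseˡ y)) (K.+-identityʳ x))

  a+c≡b+d⇒a-b≡d-c : ∀ a b c d → a +ᴿ c ≡ b +ᴿ d → a +ᴿ (-ᴿ b) ≡ d +ᴿ (-ᴿ c)
  a+c≡b+d⇒a-b≡d-c a b c d eq = begin
    a +ᴿ (-ᴿ b)                       ≡⟨ sym (x+y-y≡x _ c) ⟩
    a +ᴿ (-ᴿ b) +ᴿ c +ᴿ (-ᴿ c)        ≡⟨ cong (_+ᴿ (-ᴿ c)) (swap a (-ᴿ b) c) ⟩
    a +ᴿ c +ᴿ (-ᴿ b) +ᴿ (-ᴿ c)        ≡⟨ cong (λ e → e +ᴿ (-ᴿ b) +ᴿ (-ᴿ c)) (trans eq (K.+-comm b d)) ⟩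
    d +ᴿ b +ᴿ (-ᴿ b) +ᴿ (-ᴿ c)        ≡⟨ cong (_+ᴿ (-ᴿ c)) (x+y-y≡x d b) ⟩
    d +ᴿ (-ᴿ c)                       ∎
    where
    open ≡-Reasoning
    swap : ∀ a b c → a +ᴿ b +ᴿ c ≡ a +ᴿ c +ᴿ b
    swap = solve 3 (λ a b c → a :+ b :+ c := a :+ c :+ b) refl

  ∑-translate : ∀ c f → ∑[ x ∈ allFin m ] f (c +ᴿ x) ≡ ∑ (allFin m) f
  ∑-translate c f = ∑-reindex (c +ᴿ_) ((-ᴿ c) +ᴿ_)
    (λ x → trans (sym (K.+-assoc c (-ᴿ c) x)) (trans (cong (_+ᴿ x) (K.-‿inverseʳ c)) (K.+-identityˡ x)))
    (λ x → trans (sym (K.+-assoc (-ᴿ c) c x)) (trans (cong (_+ᴿ x) (K.-‿inverseˡ c)) (K.+-identityˡ x)))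
    f

  dot-insertAt : ∀ {n} (a : Vec (Fin m) (suc n)) b i y →
    dot R a (insertAt b i y) ≡ lookup a i *ᴿ y +ᴿ dot R (removeAt a i) b
  dot-insertAt (x ∷ a)       b       fzero    y = refl
  dot-insertAt (x ∷ x′ ∷ a)  (z ∷ b) (fsuc i) y
    rewrite dot-insertAt (x′ ∷ a) b i y = swap (x *ᴿ z) _ _
    where
    swap : ∀ a b c → a +ᴿ (b +ᴿ c) ≡ b +ᴿ (a +ᴿ c)
    swap = solve 3 (λ a b c → a :+ (b :+ c) := b :+ (a :+ c)) refl

  -- The vector v + c w. It serves both for the displacement a + π^k w and for the eliminated
  -- coefficient vector w′ - κ a′.
  comb : ∀ {n} → Vec (Fin m) n → Fin m → Vec (Fin m) n → Vec (Fin m) n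
  comb v c w = zipWith (λ x y → x +ᴿ c *ᴿ y) v w

  dot-comb : ∀ {n} (v : Vec (Fin m) n) c w b → dot R (comb v c w) b ≡ dot R v b +ᴿ c *ᴿ dot R w b
  dot-comb []      c []      []      = sym (trans (K.+-identityˡ _) (K.zeroʳ c))
  dot-comb (x ∷ v) c (y ∷ w) (z ∷ b) rewrite dot-comb v c w b = rearrange x y z c _ _
    where
    rearrange : ∀ x y z c e f → (x +ᴿ c *ᴿ y) *ᴿ z +ᴿ (e +ᴿ c *ᴿ f) ≡ x *ᴿ z +ᴿ e +ᴿ c *ᴿ (y *ᴿ z +ᴿ f)
    rearrange = solve 6 (λ x y z c e f → (x :+ c :* y) :* z :+ (e :+ c :* f) := x :* z :+ e :+ c :* (y :* z :+ f)) refl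

  Invertible : Fin m → Set
  Invertible x = ∃ λ u → u *ᴿ x ≡ 1ᴿ

  Primitive : ∀ {n} → Vec (Fin m) n → Set
  Primitive a = ∃ λ i → Invertible (lookup a i)

  ∑-affine : ∀ α e t (g : Fin m → ℕ) → (inv : Invertible α) →
    ∑[ y ∈ allFin m ] (iv (α *ᴿ y +ᴿ e ≟ t) * g y) ≡ g (proj₁ inv *ᴿ (t +ᴿ (-ᴿ e)))
  ∑-affine α e t g (u , uα) = ∑-unique (λ y → α *ᴿ y +ᴿ e ≟ t) g (u *ᴿ (t +ᴿ (-ᴿ e)))
    (begin
      α *ᴿ (u *ᴿ (t +ᴿ (-ᴿ e))) +ᴿ e     ≡⟨ cong (_+ᴿ e) (assoc α u _) ⟩
      u *ᴿ α *ᴿ (t +ᴿ (-ᴿ e)) +ᴿ e       ≡⟨ cong (λ z → z *ᴿ (t +ᴿ (-ᴿ e)) +ᴿ e) uα ⟩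
      1ᴿ *ᴿ (t +ᴿ (-ᴿ e)) +ᴿ e           ≡⟨ cong (_+ᴿ e) (K.*-identityˡ _) ⟩
      t +ᴿ (-ᴿ e) +ᴿ e                   ≡⟨ x-y+y≡x t e ⟩
      t                                  ∎)
    (λ y eq → begin
      y                                  ≡⟨ sym (K.*-identityˡ y) ⟩
      1ᴿ *ᴿ y                            ≡⟨ cong (_*ᴿ y) (sym uα) ⟩
      u *ᴿ α *ᴿ y                        ≡⟨ K.*-assoc u α y ⟩
      u *ᴿ (α *ᴿ y)                      ≡⟨ cong (u *ᴿ_) (sym (x+y-y≡x (α *ᴿ y) e)) ⟩
      u *ᴿ (α *ᴿ y +ᴿ e +ᴿ (-ᴿ e))       ≡⟨ cong (λ z → u *ᴿ (z +ᴿ (-ᴿ e))) eq ⟩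
      u *ᴿ (t +ᴿ (-ᴿ e))                 ∎)
    where
    open ≡-Reasoning
    assoc : ∀ a b c → a *ᴿ (b *ᴿ c) ≡ b *ᴿ a *ᴿ c
    assoc = solve 3 (λ a b c → a :* (b :* c) := b :* a :* c) refl

  ∑-affine₁ : ∀ α e t → Invertible α → ∑[ y ∈ allFin m ] iv (α *ᴿ y +ᴿ e ≟ t) ≡ 1
  ∑-affine₁ α e t inv = trans (∑-cong (allFin m) (λ y → sym (*-identityʳ _))) (∑-affine α e t (λ _ → 1) inv)

  -- The other n coordinates are free and determine the one with invertible coefficient. Arbitrary t
  -- is allowed because `reduced-count` uses that the values of a primitive form are equidistributed
  -- over R.
  hyperplane-size : ∀ {n} (a : Vec (Fin m) (suc n)) t → Primitive a →
    ∑[ b ∈ allVecs (suc n) ] iv (dot R a b ≟ t) ≡ m ^ n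
  hyperplane-size {n} a t (i , inv) = begin
    ∑[ b ∈ allVecs (suc n) ] iv (dot R a b ≟ t)
      ≡⟨ ∑-insertAt n i _ ⟩
    ∑[ b ∈ allVecs n ] ∑[ y ∈ allFin m ] iv (dot R a (insertAt b i y) ≟ t)
      ≡⟨ ∑-cong (allVecs n) (λ b → ∑-cong (allFin m) (λ y → cong (λ e → iv (e ≟ t)) (dot-insertAt a b i y))) ⟩
    ∑[ b ∈ allVecs n ] ∑[ y ∈ allFin m ] iv (lookup a i *ᴿ y +ᴿ dot R (removeAt a i) b ≟ t)
      ≡⟨ ∑-cong (allVecs n) (λ b → ∑-affine₁ (lookup a i) _ t inv) ⟩
    ∑[ b ∈ allVecs n ] 1
      ≡⟨ ∑-1-allVecs n ⟩
    m ^ n ∎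
    where open ≡-Reasoning

  -- The chain of ideals π^k R and their annihilators.

  module ValuationRing (π : Fin m) (maximal : IsMaximalIdeal R (⟨_⟩ R π))
    (q ℓ : ℕ) (residue : ResidueCard R π q) (nil : NilDegree R π ℓ) where

    π^ : ℕ → Fin m
    π^ = pow R π

    1∉⟨π⟩ : ¬ ⟨_⟩ R π 1ᴿ
    1∉⟨π⟩ = proj₁ (proj₂ maximal)

    ⟨π⟩-+ : ∀ {x y} → ⟨_⟩ R π x → ⟨_⟩ R π y → ⟨_⟩ R π (x +ᴿ y)
    ⟨π⟩-+ = IsIdeal.+-closed (proj₁ maximal) _ _

    ⟨π⟩-* : ∀ r {x} → ⟨_⟩ R π x → ⟨_⟩ R π (r *ᴿ x)
    ⟨π⟩-* r = IsIdeal.*-closed (proj₁ maximal) r _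

    ⟨π⟩-neg : ∀ {x} → ⟨_⟩ R π x → ⟨_⟩ R π (-ᴿ x)
    ⟨π⟩-neg (r , refl) = -ᴿ r , -‿distribˡ-* r π

    -- Maximality gives 1 = rπ + sx, and s x = 1 − rπ is invertible because π is nilpotent.
    ⟨π⟩-or-invertible : ∀ x → ⟨_⟩ R π x ⊎ Invertible x
    ⟨π⟩-or-invertible x with proj₂ (proj₂ maximal) J J-ideal
                          (λ { y (r , eq) → r , 0ᴿ , trans eq (sym (trans (cong (r *ᴿ π +ᴿ_) (K.zeroˡ x)) (K.+-identityʳ _))) })
      where
      J : Fin m → Set
      J y = ∃ λ r → ∃ λ s → y ≡ r *ᴿ π +ᴿ s *ᴿ x
      J-ideal : IsIdeal R J
      J-ideal = record
        { zero-mem = 0ᴿ , 0ᴿ , solve 2 (λ p x → con 0 := con 0 :* p :+ con 0 :* x) refl π x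
        ; +-closed = λ { _ _ (r , s , refl) (r′ , s′ , refl) → r +ᴿ r′ , s +ᴿ s′ ,
            solve 6 (λ r s r′ s′ p x → (r :* p :+ s :* x) :+ (r′ :* p :+ s′ :* x) := (r :+ r′) :* p :+ (s :+ s′) :* x)
              refl r s r′ s′ π x }
        ; *-closed = λ { c _ (r , s , refl) → c *ᴿ r , c *ᴿ s ,
            solve 5 (λ c r s p x → c :* (r :* p :+ s :* x) := c :* r :* p :+ c :* s :* x) refl c r s π x }
        }
    ... | inj₁ J⊆⟨π⟩ = inj₁ (J⊆⟨π⟩ x (0ᴿ , 1ᴿ , solve 2 (λ p x → x := con 0 :* p :+ con 1 :* x) refl π x))
    ... | inj₂ all∈J with all∈J 1ᴿ
    ...   | r , s , 1≡ = inj₂ (from (geometric ℓ))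
      where
      open ≡-Reasoning
      geometric : ∀ k → ∃ λ u → ∃ λ t → 1ᴿ ≡ u *ᴿ x +ᴿ t *ᴿ π^ k
      geometric zero    = 0ᴿ , 1ᴿ , solve 1 (λ x → con 1 := con 0 :* x :+ con 1 :* con 1) refl x
      geometric (suc k) with geometric k
      ... | u , t , eq = u +ᴿ t *ᴿ π^ k *ᴿ s , t *ᴿ r , (begin
        1ᴿ                                                         ≡⟨ eq ⟩
        u *ᴿ x +ᴿ t *ᴿ π^ k                                        ≡⟨ cong (u *ᴿ x +ᴿ_) (sym (K.*-identityʳ _)) ⟩
        u *ᴿ x +ᴿ t *ᴿ π^ k *ᴿ 1ᴿ                                  ≡⟨ cong (λ e → u *ᴿ x +ᴿ t *ᴿ π^ k *ᴿ e) 1≡ ⟩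
        u *ᴿ x +ᴿ t *ᴿ π^ k *ᴿ (r *ᴿ π +ᴿ s *ᴿ x)                  ≡⟨ rearrange u t (π^ k) r s π x ⟩
        (u +ᴿ t *ᴿ π^ k *ᴿ s) *ᴿ x +ᴿ t *ᴿ r *ᴿ (π *ᴿ π^ k)        ∎)
        where
        rearrange : ∀ u t P r s p x → u *ᴿ x +ᴿ t *ᴿ P *ᴿ (r *ᴿ p +ᴿ s *ᴿ x) ≡ (u +ᴿ t *ᴿ P *ᴿ s) *ᴿ x +ᴿ t *ᴿ r *ᴿ (p *ᴿ P)
        rearrange = solve 7 (λ u t P r s p x → u :* x :+ t :* P :* (r :* p :+ s :* x) := (u :+ t :* P :* s) :* x :+ t :* r :* (p :* P)) refl
      from : (∃ λ u → ∃ λ t → 1ᴿ ≡ u *ᴿ x +ᴿ t *ᴿ π^ ℓ) → Invertible x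
      from (u , t , eq) = u , sym (begin
        1ᴿ                    ≡⟨ eq ⟩
        u *ᴿ x +ᴿ t *ᴿ π^ ℓ   ≡⟨ cong (λ e → u *ᴿ x +ᴿ t *ᴿ e) (proj₁ (proj₂ nil)) ⟩
        u *ᴿ x +ᴿ t *ᴿ 0ᴿ     ≡⟨ trans (cong (u *ᴿ x +ᴿ_) (K.zeroʳ t)) (K.+-identityʳ _) ⟩
        u *ᴿ x                ∎)

    invertible∉⟨π⟩ : ∀ {x} → Invertible x → ¬ ⟨_⟩ R π x
    invertible∉⟨π⟩ (u , eq) x∈ = 1∉⟨π⟩ (subst (⟨_⟩ R π) eq (⟨π⟩-* u x∈))

    π^≢0 : ∀ k → k < ℓ → π^ k ≢ 0ᴿ
    -- `NilDegree` only covers exponents k ≥ 1; for k = 0, the equation 1 = 0 would put 1 into (π).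
    π^≢0 zero    k<ℓ eq = 1∉⟨π⟩ (0ᴿ , trans eq (sym (K.zeroˡ π)))
    π^≢0 (suc k) k<ℓ    = proj₂ (proj₂ nil) (suc k) (s≤s z≤n) k<ℓ

    -- Otherwise z is invertible, and cancelling it leaves π^k = 0 with k < ℓ.
    π^z≡0⇒z∈⟨π⟩ : ∀ k → k < ℓ → ∀ z → π^ k *ᴿ z ≡ 0ᴿ → ⟨_⟩ R π z
    π^z≡0⇒z∈⟨π⟩ k k<ℓ z eq with ⟨π⟩-or-invertible z
    ... | inj₁ z∈       = z∈
    ... | inj₂ (u , uz) = ⊥-elim (π^≢0 k k<ℓ (begin
      π^ k                  ≡⟨ sym (K.*-identityʳ _) ⟩
      π^ k *ᴿ 1ᴿ            ≡⟨ cong (π^ k *ᴿ_) (sym uz) ⟩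
      π^ k *ᴿ (u *ᴿ z)      ≡⟨ solve 3 (λ a b c → a :* (b :* c) := b :* (a :* c)) refl (π^ k) u z ⟩
      u *ᴿ (π^ k *ᴿ z)      ≡⟨ trans (cong (u *ᴿ_) eq) (K.zeroʳ u) ⟩
      0ᴿ                    ∎))
      where open ≡-Reasoning

    π^-cancel : ∀ k → k < ℓ → ∀ a b → π^ k *ᴿ a ≡ π^ k *ᴿ b → ⟨_⟩ R π (a +ᴿ (-ᴿ b))
    π^-cancel k k<ℓ a b eq = π^z≡0⇒z∈⟨π⟩ k k<ℓ _ (begin
      π^ k *ᴿ (a +ᴿ (-ᴿ b))                 ≡⟨ K.distribˡ (π^ k) a (-ᴿ b) ⟩
      π^ k *ᴿ a +ᴿ π^ k *ᴿ (-ᴿ b)           ≡⟨ cong₂ _+ᴿ_ eq (sym (-‿distribʳ-* (π^ k) b)) ⟩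
      π^ k *ᴿ b +ᴿ (-ᴿ (π^ k *ᴿ b))         ≡⟨ K.-‿inverseʳ _ ⟩
      0ᴿ                                    ∎)
      where open ≡-Reasoning

    -- The multiplier r is kept explicit: the multipliers of all coordinates form the vector w in a′
    -- = a + π^k w.
    Cong : ℕ → Fin m → Fin m → Set
    Cong k x y = ∃ λ r → y ≡ x +ᴿ π^ k *ᴿ r

    cong? : ∀ k x y → Dec (Cong k x y)
    cong? k x y = any? (λ r → y ≟ x +ᴿ π^ k *ᴿ r)

    idealSize : ℕ → ℕ
    idealSize k = ∑[ x ∈ allFin m ] iv (cong? k 0ᴿ x)

    congClass-size : ∀ k c → ∑[ x ∈ allFin m ] iv (cong? k c x) ≡ idealSize k
    congClass-size k c = trans (sym (∑-translate c (λ x → iv (cong? k c x))))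
      (∑-cong (allFin m) (λ x → iv-cong (cong? k c (c +ᴿ x)) (cong? k 0ᴿ x)
        (λ (r , eq) → r , trans (+ᴿ-cancelˡ c x _ eq) (sym (K.+-identityˡ _)))
        (λ (r , eq) → r , cong (c +ᴿ_) (trans eq (K.+-identityˡ _)))))

    -- The q cosets of π^(k+1) R inside π^k R are represented by π^k times the residue
    -- representatives; they are distinct because π^k can be cancelled modulo π while k < ℓ.
    idealSize-step : ∀ k → k < ℓ → idealSize k ≡ q * idealSize (suc k)
    idealSize-step k k<ℓ = begin
      ∑[ x ∈ allFin m ] iv (cong? k 0ᴿ x)
        ≡⟨ ∑-cong (allFin m) split ⟩
      ∑[ x ∈ allFin m ] ∑[ i ∈ allFin q ] iv (cong? (suc k) (π^ k *ᴿ rep i) x)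
        ≡⟨ ∑-swap (allFin m) (allFin q) (λ x i → iv (cong? (suc k) (π^ k *ᴿ rep i) x)) ⟩
      ∑[ i ∈ allFin q ] ∑[ x ∈ allFin m ] iv (cong? (suc k) (π^ k *ᴿ rep i) x)
        ≡⟨ ∑-cong (allFin q) (λ i → trans (congClass-size (suc k) _) (sym (*-identityˡ _))) ⟩
      ∑[ i ∈ allFin q ] (1 * idealSize (suc k))
        ≡⟨ trans (∑-*ʳ (allFin q) (λ _ → 1) _) (cong (_* idealSize (suc k)) (∑-1-allFin q)) ⟩
      q * idealSize (suc k) ∎
      where
      open ≡-Reasoning
      rep = proj₁ residue
      lift : ∀ y t → π^ k *ᴿ y +ᴿ π^ (suc k) *ᴿ t ≡ π^ k *ᴿ (y +ᴿ t *ᴿ π)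
      lift = solve 4 (λ P p y t → P :* y :+ p :* P :* t := P :* (y :+ t :* p)) refl (π^ k) π
      split : ∀ x → iv (cong? k 0ᴿ x) ≡ ∑[ i ∈ allFin q ] iv (cong? (suc k) (π^ k *ᴿ rep i) x)
      split x with cong? k 0ᴿ x
      ... | no ∉ = sym (∑-zero (allFin q) (λ i → iv-no (cong? (suc k) (π^ k *ᴿ rep i) x)
              (λ (t , eq) → ∉ (rep i +ᴿ t *ᴿ π , trans eq (trans (lift (rep i) t) (sym (K.+-identityˡ _)))))))
      -- With x = π^k r, the coset containing x is indexed by the residue class of r.
      ... | yes (r , eq) with proj₂ (proj₂ residue) r
      ...   | i , t , r-i = sym (∑-unique₁ (λ j → cong? (suc k) (π^ k *ᴿ rep j) x) i
              (t , trans x≡ (sym (lift (rep i) t)))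
              (λ j (t′ , eq′) → proj₁ (proj₂ residue) j i
                (same j t′ (π^-cancel k k<ℓ _ _ (trans (sym (lift (rep j) t′)) (trans (sym eq′) x≡))))))
        where
        r≡ : r ≡ rep i +ᴿ t *ᴿ π
        r≡ = trans (sym (x-y+y≡x r (rep i))) (trans (cong (_+ᴿ rep i) r-i) (K.+-comm _ _))
        x≡ : x ≡ π^ k *ᴿ (rep i +ᴿ t *ᴿ π)
        x≡ = trans eq (trans (K.+-identityˡ _) (cong (π^ k *ᴿ_) r≡))
        same : ∀ j t′ → ⟨_⟩ R π ((rep j +ᴿ t′ *ᴿ π) +ᴿ (-ᴿ (rep i +ᴿ t *ᴿ π))) → ⟨_⟩ R π (rep j +ᴿ (-ᴿ rep i))
        same j t′ (s , d) = subst (⟨_⟩ R π)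
          (sym (a+c≡b+d⇒a-b≡d-c (rep j) (rep i) (t′ *ᴿ π) (s *ᴿ π +ᴿ t *ᴿ π) (begin
            rep j +ᴿ t′ *ᴿ π                        ≡⟨ sym (x-y+y≡x _ (rep i +ᴿ t *ᴿ π)) ⟩
            _ +ᴿ (-ᴿ (rep i +ᴿ t *ᴿ π)) +ᴿ (rep i +ᴿ t *ᴿ π) ≡⟨ cong (_+ᴿ (rep i +ᴿ t *ᴿ π)) d ⟩
            s *ᴿ π +ᴿ (rep i +ᴿ t *ᴿ π)             ≡⟨ solve 3 (λ a b c → a :+ (b :+ c) := b :+ (a :+ c)) refl (s *ᴿ π) (rep i) (t *ᴿ π) ⟩
            rep i +ᴿ (s *ᴿ π +ᴿ t *ᴿ π)             ∎)))
          (⟨π⟩-+ (⟨π⟩-+ (s , refl) (t , refl)) (⟨π⟩-neg (t′ , refl)))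

    idealSize-ℓ : idealSize ℓ ≡ 1
    idealSize-ℓ = ∑-unique₁ (cong? ℓ 0ᴿ) 0ᴿ
      (0ᴿ , sym (trans (K.+-identityˡ _) (K.zeroʳ _)))
      (λ x (r , eq) → trans eq (trans (K.+-identityˡ _) (trans (cong (_*ᴿ r) (proj₁ (proj₂ nil))) (K.zeroˡ r))))

    idealSize≡q^ : ∀ j k → k + j ≡ ℓ → idealSize k ≡ q ^ j
    idealSize≡q^ zero    k eq = trans (cong idealSize (trans (sym (+-identityʳ k)) eq)) idealSize-ℓ
    idealSize≡q^ (suc j) k eq =
      trans (idealSize-step k (≤-trans (m≤m+n (suc k) j) (≤-reflexive eq′)))
            (cong (q *_) (idealSize≡q^ j (suc k) eq′))
      where
      eq′ : suc k + j ≡ ℓ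
      eq′ = trans (sym (+-suc k j)) eq

    m≡q^ℓ : m ≡ q ^ ℓ
    m≡q^ℓ = trans (sym (trans (∑-cong (allFin m) (λ x → iv-yes (cong? 0 0ᴿ x)
                                (x , sym (trans (K.+-identityˡ _) (K.*-identityˡ x)))))
                              (∑-1-allFin m)))
                  (idealSize≡q^ ℓ 0 refl)

    -- A single representative would be congruent to both 0 and 1, forcing 1 into (π). The
    -- cardinality is a variable c so that it can be split into cases.
    residueCard>1 : ∀ {c} → ResidueCard R π c → 1 < c
    residueCard>1 {zero}        (_ , _ , cover) with () , _ ← cover 0ᴿ
    residueCard>1 {suc (suc _)} _ = s≤s (s≤s z≤n)
    residueCard>1 {suc zero}    (rep , _ , cover) with cover 0ᴿ | cover 1ᴿ
    ... | fzero , 0∈ | fzero , 1∈ = ⊥-elim (1∉⟨π⟩ (subst (⟨_⟩ R π) (x-y+y≡x 1ᴿ _) (⟨π⟩-+ 1∈ rep∈)))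
      where
      rep∈ : ⟨_⟩ R π (rep fzero)
      rep∈ = subst (⟨_⟩ R π) (trans (cong -ᴿ_ (K.+-identityˡ _)) (-‿involutive _)) (⟨π⟩-neg 0∈)

    q>1 : 1 < q
    q>1 = residueCard>1 residue

    annSize : ℕ → ℕ
    annSize k = ∑[ x ∈ allFin m ] iv (π^ k *ᴿ x ≟ 0ᴿ)

    -- Multiplication by π^k is an additive map with image π^k R, and each nonempty fibre is a
    -- translate of its kernel.
    idealSize*annSize : ∀ k → idealSize k * annSize k ≡ m
    idealSize*annSize k = sym (begin
      m                                                            ≡⟨ sym (∑-1-allFin m) ⟩
      ∑[ x ∈ allFin m ] 1
        ≡⟨ ∑-cong (allFin m) (λ x → sym (∑-unique₁ (π^ k *ᴿ x ≟_) (π^ k *ᴿ x) refl (λ _ → sym))) ⟩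
      ∑[ x ∈ allFin m ] ∑[ y ∈ allFin m ] iv (π^ k *ᴿ x ≟ y)       ≡⟨ ∑-swap (allFin m) (allFin m) (λ x y → iv (π^ k *ᴿ x ≟ y)) ⟩
      ∑[ y ∈ allFin m ] ∑[ x ∈ allFin m ] iv (π^ k *ᴿ x ≟ y)       ≡⟨ ∑-cong (allFin m) fibre ⟩
      ∑[ y ∈ allFin m ] (iv (cong? k 0ᴿ y) * annSize k)            ≡⟨ ∑-*ʳ (allFin m) _ (annSize k) ⟩
      idealSize k * annSize k                                      ∎)
      where
      open ≡-Reasoning
      fibre : ∀ y → ∑[ x ∈ allFin m ] iv (π^ k *ᴿ x ≟ y) ≡ iv (cong? k 0ᴿ y) * annSize k
      fibre y with cong? k 0ᴿ y
      ... | no ∉ = ∑-zero (allFin m) (λ x → iv-no (π^ k *ᴿ x ≟ y) (λ eq → ∉ (x , trans (sym eq) (sym (K.+-identityˡ _)))))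
      ... | yes (r , eq) = trans (sym (∑-translate r (λ x → iv (π^ k *ᴿ x ≟ y))))
              (trans (∑-cong (allFin m) (λ x → iv-cong (π^ k *ᴿ (r +ᴿ x) ≟ y) (π^ k *ᴿ x ≟ 0ᴿ)
                 (λ e → +ᴿ-cancelˡ y _ _ (trans (expand x) (trans e (sym (K.+-identityʳ y)))))
                 (λ e → trans (sym (expand x)) (trans (cong (y +ᴿ_) e) (K.+-identityʳ y)))))
              (sym (*-identityˡ (annSize k))))
        where
        expand : ∀ x → y +ᴿ π^ k *ᴿ x ≡ π^ k *ᴿ (r +ᴿ x)
        expand x = trans (cong (_+ᴿ π^ k *ᴿ x) (trans eq (K.+-identityˡ _))) (sym (K.distribˡ (π^ k) r x))

    annSize≡q^ : ∀ k → k ≤ ℓ → annSize k ≡ q ^ k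
    annSize≡q^ k k≤ℓ = *-cancelˡ-≡ (annSize k) (q ^ k) (q ^ (ℓ ∸ k)) {{m^n≢0 q (ℓ ∸ k) {{>-nonZero (<-trans (s≤s z≤n) q>1)}}}} (begin
      q ^ (ℓ ∸ k) * annSize k    ≡⟨ cong (_* annSize k) (sym (idealSize≡q^ (ℓ ∸ k) k (m+[n∸m]≡n k≤ℓ))) ⟩
      idealSize k * annSize k    ≡⟨ trans (idealSize*annSize k) m≡q^ℓ ⟩
      q ^ ℓ                      ≡⟨ cong (q ^_) (sym (m∸n+n≡m k≤ℓ)) ⟩
      q ^ (ℓ ∸ k + k)            ≡⟨ ^-distribˡ-+-* q (ℓ ∸ k) k ⟩
      q ^ (ℓ ∸ k) * q ^ k        ∎)
      where open ≡-Reasoning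

    -- Primitive vectors and single equations.

    -- A positive form of the negation of `Primitive`; the quotients by π in each coordinate are
    -- used later as data.
    NonPrimitive : ∀ {n} → Vec (Fin m) n → Set
    NonPrimitive a = ∀ i → ⟨_⟩ R π (lookup a i)

    nonPrimitive-or-primitive : ∀ {n} (a : Vec (Fin m) n) → NonPrimitive a ⊎ Primitive a
    nonPrimitive-or-primitive []      = inj₁ (λ ())
    nonPrimitive-or-primitive (x ∷ a) with ⟨π⟩-or-invertible x | nonPrimitive-or-primitive a
    ... | inj₂ inv | _              = inj₂ (fzero , inv)
    ... | inj₁ x∈  | inj₂ (i , inv) = inj₂ (fsuc i , inv)
    ... | inj₁ x∈  | inj₁ a∈        = inj₁ (λ { fzero → x∈ ; (fsuc i) → a∈ i })

    primitive⇒¬nonPrimitive : ∀ {n} (a : Vec (Fin m) n) → Primitive a → ¬ NonPrimitive a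
    primitive⇒¬nonPrimitive a (i , inv) a∈ = invertible∉⟨π⟩ inv (a∈ i)

    primitive? : ∀ {n} (a : Vec (Fin m) n) → Dec (Primitive a)
    primitive? a with nonPrimitive-or-primitive a
    ... | inj₁ np = no (λ p → primitive⇒¬nonPrimitive a p np)
    ... | inj₂ p  = yes p

    nonPrimitive? : ∀ {n} (a : Vec (Fin m) n) → Dec (NonPrimitive a)
    nonPrimitive? a with nonPrimitive-or-primitive a
    ... | inj₁ np = yes np
    ... | inj₂ p  = no (primitive⇒¬nonPrimitive a p)

    primitive+nonPrimitive : ∀ {n} (a : Vec (Fin m) n) → iv (primitive? a) + iv (nonPrimitive? a) ≡ 1
    primitive+nonPrimitive a with nonPrimitive-or-primitive a
    ... | inj₁ np = refl
    ... | inj₂ p  = refl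

    dot-nonPrimitive : ∀ {n} (a : Vec (Fin m) n) b → NonPrimitive a → ⟨_⟩ R π (dot R a b)
    dot-nonPrimitive []      []      np = 0ᴿ , sym (K.zeroˡ π)
    dot-nonPrimitive (x ∷ a) (y ∷ b) np =
      ⟨π⟩-+ (subst (⟨_⟩ R π) (K.*-comm y x) (⟨π⟩-* y (np fzero))) (dot-nonPrimitive a b (np ∘ fsuc))

    dot-nonPrimitive≢1 : ∀ {n} (a : Vec (Fin m) n) b → NonPrimitive a → dot R a b ≢ 1ᴿ
    dot-nonPrimitive≢1 a b np eq = 1∉⟨π⟩ (subst (⟨_⟩ R π) eq (dot-nonPrimitive a b np))

    degree : ∀ {n} (a : Vec (Fin m) (suc n)) →
      ∑[ b ∈ allVecs (suc n) ] iv (dot R a b ≟ 1ᴿ) ≡ iv (primitive? a) * m ^ n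
    degree {n} a with nonPrimitive-or-primitive a
    ... | inj₁ np = ∑-zero (allVecs (suc n)) (λ b → iv-no (dot R a b ≟ 1ᴿ) (dot-nonPrimitive≢1 a b np))
    ... | inj₂ p  = trans (hyperplane-size a 1ᴿ p) (sym (*-identityˡ (m ^ n)))

    -- Pairs of equations.

    codegree : ∀ {n} (a a′ : Vec (Fin m) n) → ℕ
    codegree {n} a a′ = ∑[ b ∈ allVecs n ] (iv (dot R a b ≟ 1ᴿ) * iv (dot R a′ b ≟ 1ᴿ))

    nonPrimitive-removeAt : ∀ {n} (w : Vec (Fin m) (suc n)) i → ⟨_⟩ R π (lookup w i) →
                            NonPrimitive (removeAt w i) → NonPrimitive w
    nonPrimitive-removeAt w i wᵢ∈ np j with i ≟ j
    ... | yes refl = wᵢ∈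
    ... | no i≢j   = subst (⟨_⟩ R π) (removeAt-punchOut w i≢j) (np (punchOut i≢j))

    -- Solving a · b = 1 for the coordinate where a is invertible turns w · b
    -- into κ + v · b′ for the remaining coordinates b′.
    module Eliminate {n} (a w : Vec (Fin m) (suc (suc n))) (prim-a : Primitive a) where
      i = proj₁ prim-a
      u = proj₁ (proj₂ prim-a)
      κ = lookup w i *ᴿ u
      a′ = removeAt a i
      w′ = removeAt w i
      v = comb w′ (-ᴿ κ) a′

      -- Multiplying a · b = 1 by κ = wᵢ u gives wᵢ y = κ - κ (a′ · b), because u inverts aᵢ.
      -- Substituting this removes y.
      eliminate : ∀ b y → lookup a i *ᴿ y +ᴿ dot R a′ b ≡ 1ᴿ →
                  lookup w i *ᴿ y +ᴿ dot R w′ b ≡ κ +ᴿ dot R v b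
      eliminate b y eq = sym (begin
        κ +ᴿ dot R v b                                    ≡⟨ cong (κ +ᴿ_) (dot-comb w′ (-ᴿ κ) a′ b) ⟩
        κ +ᴿ (f +ᴿ (-ᴿ κ) *ᴿ e)                           ≡⟨ cong₂ (λ s t → s +ᴿ (f +ᴿ t)) (sym (K.*-identityʳ κ)) (sym (-‿distribˡ-* κ e)) ⟩
        κ *ᴿ 1ᴿ +ᴿ (f +ᴿ (-ᴿ (κ *ᴿ e)))                   ≡⟨ cong (λ s → κ *ᴿ s +ᴿ (f +ᴿ (-ᴿ (κ *ᴿ e)))) (sym eq) ⟩
        ω *ᴿ u *ᴿ (α *ᴿ y +ᴿ e) +ᴿ (f +ᴿ (-ᴿ (κ *ᴿ e)))   ≡⟨ rearrange ω u α y e f _ ⟩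
        ω *ᴿ (u *ᴿ α) *ᴿ y +ᴿ f +ᴿ κ *ᴿ e +ᴿ (-ᴿ (κ *ᴿ e)) ≡⟨ x+y-y≡x _ (κ *ᴿ e) ⟩
        ω *ᴿ (u *ᴿ α) *ᴿ y +ᴿ f                           ≡⟨ cong (λ s → ω *ᴿ s *ᴿ y +ᴿ f) (proj₂ (proj₂ prim-a)) ⟩
        ω *ᴿ 1ᴿ *ᴿ y +ᴿ f                                 ≡⟨ cong (λ s → s *ᴿ y +ᴿ f) (K.*-identityʳ ω) ⟩
        ω *ᴿ y +ᴿ f                                       ∎)
        where
        open ≡-Reasoning
        α = lookup a i
        ω = lookup w i
        e = dot R a′ b
        f = dot R w′ b
        rearrange : ∀ ω u α y e f n →
          ω *ᴿ u *ᴿ (α *ᴿ y +ᴿ e) +ᴿ (f +ᴿ n) ≡ ω *ᴿ (u *ᴿ α) *ᴿ y +ᴿ f +ᴿ ω *ᴿ u *ᴿ e +ᴿ n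
        rearrange = solve 7 (λ ω u α y e f n →
          ω :* u :* (α :* y :+ e) :+ (f :+ n) := ω :* (u :* α) :* y :+ f :+ ω :* u :* e :+ n) refl

      -- A non-primitive v means w ≡ κ a modulo π: indeed wᵢ = aᵢ κ and w′ = v + κ a′. If κ were in
      -- (π) as well, then w would vanish modulo π.
      κ∉⟨π⟩ : Primitive w → NonPrimitive v → ¬ ⟨_⟩ R π κ
      κ∉⟨π⟩ prim-w np κ∈ = primitive⇒¬nonPrimitive w prim-w (nonPrimitive-removeAt w i
        (subst (⟨_⟩ R π) ακ≡ω (⟨π⟩-* (lookup a i) κ∈))
        (λ j → subst (⟨_⟩ R π) (v+κa j)
          (⟨π⟩-+ (np j) (subst (⟨_⟩ R π) (K.*-comm (lookup a′ j) κ) (⟨π⟩-* (lookup a′ j) κ∈)))))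
        where
        open ≡-Reasoning
        ακ≡ω : lookup a i *ᴿ κ ≡ lookup w i
        ακ≡ω = trans (solve 3 (λ α ω u → α :* (ω :* u) := ω :* (u :* α)) refl (lookup a i) (lookup w i) u)
                     (trans (cong (lookup w i *ᴿ_) (proj₂ (proj₂ prim-a))) (K.*-identityʳ _))
        v+κa : ∀ j → lookup v j +ᴿ κ *ᴿ lookup a′ j ≡ lookup w′ j
        v+κa j = begin
          lookup v j +ᴿ κ *ᴿ lookup a′ j
            ≡⟨ cong (_+ᴿ κ *ᴿ lookup a′ j) (lookup-zipWith _ j w′ a′) ⟩
          lookup w′ j +ᴿ (-ᴿ κ) *ᴿ lookup a′ j +ᴿ κ *ᴿ lookup a′ j
            ≡⟨ cong (λ s → lookup w′ j +ᴿ s +ᴿ κ *ᴿ lookup a′ j) (sym (-‿distribˡ-* κ _)) ⟩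
          lookup w′ j +ᴿ (-ᴿ (κ *ᴿ lookup a′ j)) +ᴿ κ *ᴿ lookup a′ j
            ≡⟨ x-y+y≡x _ _ ⟩
          lookup w′ j ∎

      reduced-count : Primitive w → ∀ k → k < ℓ →
        ∑[ b ∈ allVecs (suc n) ] iv (π^ k *ᴿ (κ +ᴿ dot R v b) ≟ 0ᴿ) ≤ m ^ n * q ^ k
      reduced-count prim-w k k<ℓ with nonPrimitive-or-primitive v
      -- Here v · b lies in (π) and κ does not, so κ + v · b is outside (π) and π^k with k < ℓ
      -- cannot kill it: there are no solutions.
      ... | inj₁ np = ≤-trans (≤-reflexive (∑-zero (allVecs (suc n)) (λ b → iv-no (_ ≟ 0ᴿ) (λ eq →
              κ∉⟨π⟩ prim-w np (subst (⟨_⟩ R π) (x+y-y≡x κ _)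
                (⟨π⟩-+ (π^z≡0⇒z∈⟨π⟩ k k<ℓ _ eq) (⟨π⟩-neg (dot-nonPrimitive v b np)))))))) z≤n
      ... | inj₂ p  = ≤-reflexive (begin
        -- Group the b by the value t = v · b; each t occurs m^n times, and κ + t runs through the
        -- annihilator of π^k.
        ∑[ b ∈ allVecs (suc n) ] g (dot R v b)
          ≡⟨ ∑-cong (allVecs (suc n)) (λ b → sym (∑-unique (dot R v b ≟_) g (dot R v b) refl (λ _ → sym))) ⟩
        ∑[ b ∈ allVecs (suc n) ] ∑[ t ∈ allFin m ] (iv (dot R v b ≟ t) * g t)
          ≡⟨ ∑-swap (allVecs (suc n)) (allFin m) (λ b t → iv (dot R v b ≟ t) * g t) ⟩
        ∑[ t ∈ allFin m ] ∑[ b ∈ allVecs (suc n) ] (iv (dot R v b ≟ t) * g t)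
          ≡⟨ ∑-cong (allFin m) (λ t → trans (∑-*ʳ (allVecs (suc n)) (λ b → iv (dot R v b ≟ t)) (g t)) (cong (_* g t) (hyperplane-size v t p))) ⟩
        ∑[ t ∈ allFin m ] (m ^ n * g t)
          ≡⟨ ∑-*ˡ (allFin m) (m ^ n) g ⟩
        m ^ n * ∑[ t ∈ allFin m ] g t
          ≡⟨ cong (m ^ n *_) (∑-translate κ (λ x → iv (π^ k *ᴿ x ≟ 0ᴿ))) ⟩
        m ^ n * annSize k
          ≡⟨ cong (m ^ n *_) (annSize≡q^ k (<⇒≤ k<ℓ)) ⟩
        m ^ n * q ^ k ∎)
        where
        open ≡-Reasoning
        g : Fin m → ℕ
        g t = iv (π^ k *ᴿ (κ +ᴿ t) ≟ 0ᴿ)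

      codegree-comb : Primitive w → ∀ k → k < ℓ → codegree a (comb a (π^ k) w) ≤ m ^ n * q ^ k
      codegree-comb prim-w k k<ℓ = begin
        ∑[ b ∈ allVecs (suc (suc n)) ] (iv (dot R a b ≟ 1ᴿ) * iv (dot R (comb a (π^ k) w) b ≟ 1ᴿ))
          -- The difference of the two equations is π^k (w · b) = 0.
          ≤⟨ ∑-mono (allVecs (suc (suc n))) (λ b → iv-*-mono (dot R a b ≟ 1ᴿ) _ (π^ k *ᴿ dot R w b ≟ 0ᴿ) (difference b)) ⟩
        ∑[ b ∈ allVecs (suc (suc n)) ] (iv (dot R a b ≟ 1ᴿ) * iv (π^ k *ᴿ dot R w b ≟ 0ᴿ))
          ≡⟨ ∑-insertAt (suc n) i (λ b → iv (dot R a b ≟ 1ᴿ) * iv (π^ k *ᴿ dot R w b ≟ 0ᴿ)) ⟩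
        ∑[ b ∈ allVecs (suc n) ] ∑[ y ∈ allFin m ]
          (iv (dot R a (insertAt b i y) ≟ 1ᴿ) * iv (π^ k *ᴿ dot R w (insertAt b i y) ≟ 0ᴿ))
          ≡⟨ ∑-cong (allVecs (suc n)) (λ b → ∑-cong (allFin m) (λ y →
               cong₂ (λ s t → iv (s ≟ 1ᴿ) * iv (π^ k *ᴿ t ≟ 0ᴿ)) (dot-insertAt a b i y) (dot-insertAt w b i y))) ⟩
        ∑[ b ∈ allVecs (suc n) ] ∑[ y ∈ allFin m ]
          (iv (lookup a i *ᴿ y +ᴿ dot R a′ b ≟ 1ᴿ) * iv (π^ k *ᴿ (lookup w i *ᴿ y +ᴿ dot R w′ b) ≟ 0ᴿ))
          -- After elimination the second indicator no longer involves y, so the sum over y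
          -- contributes only the unique root of the first equation.
          ≤⟨ ∑-mono (allVecs (suc n)) (λ b → ∑-mono (allFin m) (λ y →
               iv-*-mono (lookup a i *ᴿ y +ᴿ dot R a′ b ≟ 1ᴿ) _ (π^ k *ᴿ (κ +ᴿ dot R v b) ≟ 0ᴿ)
                 (λ e z → trans (cong (π^ k *ᴿ_) (sym (eliminate b y e))) z))) ⟩
        ∑[ b ∈ allVecs (suc n) ] ∑[ y ∈ allFin m ]
          (iv (lookup a i *ᴿ y +ᴿ dot R a′ b ≟ 1ᴿ) * iv (π^ k *ᴿ (κ +ᴿ dot R v b) ≟ 0ᴿ))
          ≡⟨ ∑-cong (allVecs (suc n)) (λ b → ∑-affine (lookup a i) (dot R a′ b) 1ᴿ _ (proj₂ prim-a)) ⟩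
        ∑[ b ∈ allVecs (suc n) ] iv (π^ k *ᴿ (κ +ᴿ dot R v b) ≟ 0ᴿ)
          ≤⟨ reduced-count prim-w k k<ℓ ⟩
        m ^ n * q ^ k ∎
        where
        open ≤-Reasoning
        difference : ∀ b → dot R a b ≡ 1ᴿ → dot R (comb a (π^ k) w) b ≡ 1ᴿ → π^ k *ᴿ dot R w b ≡ 0ᴿ
        difference b e e′ = +ᴿ-cancelˡ 1ᴿ _ _ (trans (cong (_+ᴿ π^ k *ᴿ dot R w b) (sym e))
          (trans (sym (dot-comb a (π^ k) w b)) (trans e′ (sym (K.+-identityʳ 1ᴿ)))))

    -- Congruence levels of pairs of vectors.

    VecCong : ∀ {n} → ℕ → Vec (Fin m) n → Vec (Fin m) n → Set
    VecCong k a b = ∀ i → Cong k (lookup a i) (lookup b i)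

    vecCong? : ∀ {n} k (a b : Vec (Fin m) n) → Dec (VecCong k a b)
    vecCong? k a b = all? (λ i → cong? k (lookup a i) (lookup b i))

    vecCongClass-size : ∀ {n} k (a : Vec (Fin m) n) → ∑[ b ∈ allVecs n ] iv (vecCong? k a b) ≤ idealSize k ^ n
    vecCongClass-size k [] = +-monoˡ-≤ 0 (iv≤1 (vecCong? k [] []))
    vecCongClass-size {suc n} k (x ∷ a) = begin
      ∑[ b ∈ allVecs (suc n) ] iv (vecCong? k (x ∷ a) b)
        ≡⟨ ∑-allVecs-suc n (λ b → iv (vecCong? k (x ∷ a) b)) ⟩
      ∑[ y ∈ allFin m ] ∑[ b ∈ allVecs n ] iv (vecCong? k (x ∷ a) (y ∷ b))
        ≤⟨ ∑-mono (allFin m) (λ y → ∑-mono (allVecs n) (λ b → cons y b)) ⟩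
      ∑[ y ∈ allFin m ] ∑[ b ∈ allVecs n ] (iv (cong? k x y) * iv (vecCong? k a b))
        ≡⟨ ∑-cong (allFin m) (λ y → ∑-*ˡ (allVecs n) (iv (cong? k x y)) _) ⟩
      ∑[ y ∈ allFin m ] (iv (cong? k x y) * ∑[ b ∈ allVecs n ] iv (vecCong? k a b))
        ≡⟨ ∑-*ʳ (allFin m) _ _ ⟩
      ∑[ y ∈ allFin m ] iv (cong? k x y) * ∑[ b ∈ allVecs n ] iv (vecCong? k a b)
        ≤⟨ *-mono-≤ (≤-reflexive (congClass-size k x)) (vecCongClass-size k a) ⟩
      idealSize k * idealSize k ^ n ∎
      where
      open ≤-Reasoning
      cons : ∀ y b → iv (vecCong? k (x ∷ a) (y ∷ b)) ≤ iv (cong? k x y) * iv (vecCong? k a b)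
      cons y b with vecCong? k (x ∷ a) (y ∷ b)
      ... | no  _ = z≤n
      ... | yes c = ≤-reflexive (sym (cong₂ _*_ (iv-yes (cong? k x y) (c fzero)) (iv-yes (vecCong? k a b) (c ∘ fsuc))))

    -- Non-primitive vectors are congruent to 0 modulo π.
    nonPrimitive-size : ∀ n → ∑[ a ∈ allVecs {m} n ] iv (nonPrimitive? a) ≤ idealSize 1 ^ n
    nonPrimitive-size n = ≤-trans
      (∑-mono (allVecs n) (λ a → iv-mono (nonPrimitive? a) (vecCong? 1 (replicate n 0ᴿ) a) (λ np i → proj₁ (np i) ,
        trans (proj₂ (np i)) (trans (reorder (proj₁ (np i)))
          (cong (_+ᴿ π *ᴿ 1ᴿ *ᴿ proj₁ (np i)) (sym (lookup-replicate i 0ᴿ)))))))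
      (vecCongClass-size 1 (replicate n 0ᴿ))
      where
      reorder : ∀ r → r *ᴿ π ≡ 0ᴿ +ᴿ π *ᴿ 1ᴿ *ᴿ r
      reorder r = solve 2 (λ r p → r :* p := con 0 :+ p :* con 1 :* r) refl r π

    cong-pred : ∀ k {x y} → Cong (suc k) x y → Cong k x y
    cong-pred k {x} (r , eq) = π *ᴿ r ,
      trans eq (cong (x +ᴿ_) (solve 3 (λ p P r → p :* P :* r := P :* (p :* r)) refl π (π^ k) r))

    vecCong⇒comb : ∀ {n} k (a a′ : Vec (Fin m) n) → VecCong k a a′ → ∃ λ w → a′ ≡ comb a (π^ k) w
    vecCong⇒comb k []      []        c = [] , refl
    vecCong⇒comb k (x ∷ a) (x′ ∷ a′) c with c fzero | vecCong⇒comb k a a′ (c ∘ fsuc)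
    ... | r , eq | w , eq′ = r ∷ w , cong₂ _∷_ eq eq′

    -- A non-primitive w supplies one more factor π; so at the exact level k of a and a′ the vector
    -- w must be primitive.
    comb-nonPrimitive : ∀ {n} k (a w : Vec (Fin m) n) → NonPrimitive w → VecCong (suc k) a (comb a (π^ k) w)
    comb-nonPrimitive k a w np i = proj₁ (np i) , trans (lookup-zipWith _ i a w) (cong (lookup a i +ᴿ_)
      (trans (cong (π^ k *ᴿ_) (proj₂ (np i)))
             (solve 3 (λ P r p → P :* (r :* p) := p :* P :* r) refl (π^ k) (proj₁ (np i)) π)))

    -- The search is capped at j. It is used with j = ℓ, where the first alternative is the diagonal
    -- a′ = a because π^ℓ = 0.
    exactLevel : ∀ {n} (a a′ : Vec (Fin m) n) j →
      VecCong j a a′ ⊎ (∃ λ k → k < j × VecCong k a a′ × ¬ VecCong (suc k) a a′)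
    exactLevel a a′ zero    = inj₁ (λ i → lookup a′ i +ᴿ (-ᴿ lookup a i) ,
      sym (trans (cong (lookup a i +ᴿ_) (K.*-identityˡ _)) (trans (K.+-comm _ _) (x-y+y≡x _ _))))
    exactLevel a a′ (suc j) with exactLevel a a′ j
    ... | inj₂ (k , k<j , c , ¬c) = inj₂ (k , m<n⇒m<1+n k<j , c , ¬c)
    ... | inj₁ c with vecCong? (suc j) a a′
    ...   | yes c′ = inj₁ c′
    ...   | no ¬c′ = inj₂ (j , ≤-refl , c , ¬c′)

    -- If k ≤ j is the largest level at which a ≡ a′ mod π^k, the weight telescopes to q^k.
    weight : ∀ {n} → ℕ → Vec (Fin m) n → Vec (Fin m) n → ℕ
    weight zero    a a′ = 1
    weight (suc j) a a′ = weight j a a′ + (q ∸ 1) * q ^ j * iv (vecCong? (suc j) a a′)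

    q^suc : ∀ j → q ^ suc j ≡ q ^ j + (q ∸ 1) * q ^ j
    q^suc j = cong (_* q ^ j) (sym (m+[n∸m]≡n (<⇒≤ q>1)))

    q^≤weight : ∀ {n} j (a a′ : Vec (Fin m) n) → VecCong j a a′ → q ^ j ≤ weight j a a′
    q^≤weight zero    a a′ c = ≤-refl
    q^≤weight (suc j) a a′ c = begin
      q ^ suc j                       ≡⟨ q^suc j ⟩
      q ^ j + (q ∸ 1) * q ^ j
        ≤⟨ +-mono-≤ (q^≤weight j a a′ (cong-pred j ∘ c))
                    (≤-reflexive (sym (trans (cong ((q ∸ 1) * q ^ j *_) (iv-yes (vecCong? (suc j) a a′) c)) (*-identityʳ _)))) ⟩
      weight (suc j) a a′             ∎
      where open ≤-Reasoning

    weight-mono : ∀ {n} k d (a a′ : Vec (Fin m) n) → weight k a a′ ≤ weight (d + k) a a′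
    weight-mono k zero    a a′ = ≤-refl
    weight-mono k (suc d) a a′ = ≤-trans (weight-mono k d a a′) (m≤m+n _ _)

    codegree-primitive : ∀ {n} (a a′ : Vec (Fin m) (suc (suc n))) → Primitive a →
                         codegree a a′ ≤ m ^ n * weight ℓ a a′
    codegree-primitive {n} a a′ prim-a with exactLevel a a′ ℓ
    -- On the diagonal the second equation is dropped; the surplus factor m = q^ℓ is exactly the
    -- weight at level ℓ.
    ... | inj₁ c = begin
      codegree a a′                                            ≤⟨ ∑-mono (allVecs (suc (suc n))) (λ b →
                                                                    ≤-trans (*-monoʳ-≤ (iv (dot R a b ≟ 1ᴿ)) (iv≤1 (dot R a′ b ≟ 1ᴿ)))
                                                                            (≤-reflexive (*-identityʳ _))) ⟩
      ∑[ b ∈ allVecs (suc (suc n)) ] iv (dot R a b ≟ 1ᴿ)       ≡⟨ hyperplane-size a 1ᴿ prim-a ⟩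
      m * m ^ n                                                ≡⟨ *-comm m (m ^ n) ⟩
      m ^ n * m                                                ≤⟨ *-monoʳ-≤ (m ^ n) (subst (_≤ weight ℓ a a′) (sym m≡q^ℓ) (q^≤weight ℓ a a′ c)) ⟩
      m ^ n * weight ℓ a a′                                    ∎
      where open ≤-Reasoning
    ... | inj₂ (k , k<ℓ , c , ¬c) with vecCong⇒comb k a a′ c
    ...   | w , refl with nonPrimitive-or-primitive w
    ...     | inj₁ np     = ⊥-elim (¬c (comb-nonPrimitive k a w np))
    ...     | inj₂ prim-w = begin
      codegree a a′                       ≤⟨ Eliminate.codegree-comb a w prim-a prim-w k k<ℓ ⟩
      m ^ n * q ^ k                       ≤⟨ *-monoʳ-≤ (m ^ n) (≤-trans (q^≤weight k a a′ c) (weight-mono k (ℓ ∸ k) a a′)) ⟩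
      m ^ n * weight (ℓ ∸ k + k) a a′     ≡⟨ cong (λ j → m ^ n * weight j a a′) (m∸n+n≡m (<⇒≤ k<ℓ)) ⟩
      m ^ n * weight ℓ a a′               ∎
      where open ≤-Reasoning

    -- A non-primitive vector never has product 1. Recording this for a′ too makes the main term α²
    -- instead of α|A|, so that the cancellation leaves z² rather than z|A|.
    codegree≤ : ∀ {n} (a a′ : Vec (Fin m) (suc (suc n))) →
      codegree a a′ ≤ m ^ n * (iv (primitive? a) * (iv (primitive? a′) * weight ℓ a a′))
    codegree≤ {n} a a′ with nonPrimitive-or-primitive a | nonPrimitive-or-primitive a′
    ... | inj₁ np | _      = ≤-trans (≤-reflexive (∑-zero (allVecs (suc (suc n))) (λ b →
                               cong (_* iv (dot R a′ b ≟ 1ᴿ)) (iv-no (dot R a b ≟ 1ᴿ) (dot-nonPrimitive≢1 a b np))))) z≤n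
    ... | inj₂ p | inj₁ np = ≤-trans (≤-reflexive (∑-zero (allVecs (suc (suc n))) (λ b →
                               trans (cong (iv (dot R a b ≟ 1ᴿ) *_) (iv-no (dot R a′ b ≟ 1ᴿ) (dot-nonPrimitive≢1 a′ b np)))
                                     (*-zeroʳ (iv (dot R a b ≟ 1ᴿ)))))) z≤n
    ... | inj₂ p | inj₂ p′ = ≤-trans (codegree-primitive a a′ p)
                               (≤-reflexive (cong (m ^ n *_) (sym (trans (*-identityˡ _) (*-identityˡ _)))))

    -- Summing the weights and bounding T.

    -- The sum T of the overview, truncated after k = j.
    tail : ℕ → ℕ → ℕ
    tail n zero    = 0
    tail n (suc j) = tail n j + (q ∸ 1) * q ^ j * idealSize (suc j) ^ n

    -- The constant 1 in the weight keeps g; in every further layer g is replaced by 1 and the whole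
    -- congruence class of a is counted.
    ∑-weight : ∀ {n} j (a : Vec (Fin m) n) (g : Vec (Fin m) n → ℕ) → (∀ a′ → g a′ ≤ 1) →
      ∑[ a′ ∈ allVecs n ] (g a′ * weight j a a′) ≤ ∑ (allVecs n) g + tail n j
    ∑-weight {n} zero a g g≤1 = ≤-reflexive (trans (∑-cong (allVecs n) (λ a′ → *-identityʳ (g a′))) (sym (+-identityʳ _)))
    ∑-weight {n} (suc j) a g g≤1 = begin
      ∑[ a′ ∈ allVecs n ] (g a′ * (weight j a a′ + c * iv (vecCong? (suc j) a a′)))
        ≤⟨ ∑-mono (allVecs n) (λ a′ → ≤-trans (≤-reflexive (*-distribˡ-+ (g a′) _ _))
             (+-monoʳ-≤ (g a′ * weight j a a′) (≤-trans (*-monoˡ-≤ _ (g≤1 a′)) (≤-reflexive (*-identityˡ _))))) ⟩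
      ∑[ a′ ∈ allVecs n ] (g a′ * weight j a a′ + c * iv (vecCong? (suc j) a a′))
        ≡⟨ ∑-+ (allVecs n) _ _ ⟩
      ∑[ a′ ∈ allVecs n ] (g a′ * weight j a a′) + ∑[ a′ ∈ allVecs n ] (c * iv (vecCong? (suc j) a a′))
        ≤⟨ +-mono-≤ (∑-weight j a g g≤1)
             (≤-trans (≤-reflexive (∑-*ˡ (allVecs n) c _)) (*-monoʳ-≤ c (vecCongClass-size (suc j) a))) ⟩
      ∑ (allVecs n) g + tail n j + c * idealSize (suc j) ^ n
        ≡⟨ +-assoc (∑ (allVecs n) g) _ _ ⟩
      ∑ (allVecs n) g + tail n (suc j) ∎
      where
      open ≤-Reasoning
      c = (q ∸ 1) * q ^ j

    q^-mono : ∀ {i j} → i ≤ j → q ^ i ≤ q ^ j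
    q^-mono = ^-monoʳ-≤ q {{>-nonZero (<-trans (s≤s z≤n) q>1)}}

    module _ {L n : ℕ} (ℓ≡ : suc L ≡ ℓ) (2≤n : 2 ≤ n) where

      -- The spare term q^d drives the induction: the last layer is at most (q - 1) q^d, and
      -- together with q^d it makes q^(d+1), the spare term for the shorter sum.
      tail+q^≤ : ∀ j d → j ≤ suc L → d + j ≡ suc (L * n) → tail n j + q ^ d ≤ q ^ suc (L * n)
      tail+q^≤ zero    d j≤ eq = ≤-reflexive (cong (q ^_) (trans (sym (+-identityʳ d)) eq))
      tail+q^≤ (suc j) d j≤ eq = begin
        tail n j + (q ∸ 1) * q ^ j * idealSize (suc j) ^ n + q ^ d
          ≡⟨ cong (λ s → tail n j + (q ∸ 1) * q ^ j * s ^ n + q ^ d)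
               (idealSize≡q^ i (suc j) (trans (cong suc (m+[n∸m]≡n j≤L)) ℓ≡)) ⟩
        tail n j + (q ∸ 1) * q ^ j * (q ^ i) ^ n + q ^ d
          ≡⟨ cong (λ s → tail n j + s + q ^ d) (trans (*-assoc (q ∸ 1) (q ^ j) _) (cong ((q ∸ 1) *_)
               (trans (cong (q ^ j *_) (^-*-assoc q i n)) (sym (^-distribˡ-+-* q j (i * n)))))) ⟩
        tail n j + (q ∸ 1) * q ^ (j + i * n) + q ^ d
          ≤⟨ +-monoˡ-≤ (q ^ d) (+-monoʳ-≤ (tail n j) (*-monoʳ-≤ (q ∸ 1) (q^-mono exponent))) ⟩
        tail n j + (q ∸ 1) * q ^ d + q ^ d
          ≡⟨ trans (+-assoc (tail n j) _ _) (cong (tail n j +_) (trans (+-comm _ (q ^ d)) (sym (q^suc d)))) ⟩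
        tail n j + q ^ suc d
          ≤⟨ tail+q^≤ j (suc d) (<⇒≤ j≤) (trans (sym (+-suc d j)) eq) ⟩
        q ^ suc (L * n) ∎
        where
        open ≤-Reasoning
        i = L ∸ j
        j≤L : j ≤ L
        j≤L = s≤s⁻¹ j≤
        d+j≡ : d + j ≡ L * n
        d+j≡ = +-cancelˡ-≡ 1 _ _ (trans (sym (+-suc d j)) eq)
        exponent : j + i * n ≤ d
        -- Since d = Ln - j, the claim j + (L - j) n ≤ d amounts to 2j ≤ jn, which is where the
        -- dimension must be at least 2.
        exponent = +-cancelʳ-≤ j _ _ (begin
          j + i * n + j       ≡⟨ arrange j (i * n) ⟩
          j * 2 + i * n       ≤⟨ +-monoˡ-≤ (i * n) (*-monoʳ-≤ j 2≤n) ⟩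
          j * n + i * n       ≡⟨ sym (*-distribʳ-+ n j i) ⟩
          (j + i) * n         ≡⟨ cong (_* n) (m+[n∸m]≡n j≤L) ⟩
          L * n               ≡⟨ sym d+j≡ ⟩
          d + j               ∎)
          where
          arrange : ∀ j t → j + t + j ≡ j * 2 + t
          arrange = solve-∀

      tail< : tail n ℓ < q ^ suc (L * n)
      tail< = subst (λ j → tail n j < q ^ suc (L * n)) ℓ≡
        -- For the full sum the spare exponent is Ln - L, and q^(Ln - L) ≥ 1 makes the inequality
        -- strict.
        (≤-trans (≤-trans (≤-reflexive (+-comm 1 _)) (+-monoʳ-≤ (tail n (suc L)) (q^-mono {0} {L * n ∸ L} z≤n)))
                 (tail+q^≤ (suc L) (L * n ∸ L) ≤-refl
                   (trans (+-suc _ L) (cong suc (m∸n+n≡m (m≤m*n L n {{>-nonZero (<-trans (s≤s z≤n) 2≤n)}}))))))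

    -- The second moment over all b.

    module Variance {n : ℕ} (A : Vec (Fin m) (suc (suc n)) → Bool) where

      -- The dimension is N; thus n = N - 2 is the exponent left by two linear conditions.
      N : ℕ
      N = suc (suc n)

      vecs : List (Vec (Fin m) N)
      vecs = allVecs N

      fibre : Vec (Fin m) N → ℕ
      fibre b = ∑[ a ∈ vecs ] (𝟙 (A a) * iv (dot R a b ≟ 1ᴿ))

      ∣A∣ ∣A∣ₚ ∣A∣ₙ : ℕ
      ∣A∣  = ∑[ a ∈ vecs ] 𝟙 (A a)
      ∣A∣ₚ = ∑[ a ∈ vecs ] (𝟙 (A a) * iv (primitive? a))
      ∣A∣ₙ = ∑[ a ∈ vecs ] (𝟙 (A a) * iv (nonPrimitive? a))

      ∣A∣-split : ∣A∣ ≡ ∣A∣ₚ + ∣A∣ₙ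
      ∣A∣-split = trans (∑-cong vecs (λ a → trans (sym (*-identityʳ (𝟙 (A a))))
                          (trans (cong (𝟙 (A a) *_) (sym (primitive+nonPrimitive a))) (*-distribˡ-+ (𝟙 (A a)) _ _))))
                        (∑-+ vecs (λ a → 𝟙 (A a) * iv (primitive? a)) (λ a → 𝟙 (A a) * iv (nonPrimitive? a)))

      ∑-fibre : ∑ vecs fibre ≡ ∣A∣ₚ * m ^ suc n
      ∑-fibre = begin
        ∑[ b ∈ vecs ] ∑[ a ∈ vecs ] (𝟙 (A a) * iv (dot R a b ≟ 1ᴿ))
          ≡⟨ ∑-swap vecs vecs (λ b a → 𝟙 (A a) * iv (dot R a b ≟ 1ᴿ)) ⟩
        ∑[ a ∈ vecs ] ∑[ b ∈ vecs ] (𝟙 (A a) * iv (dot R a b ≟ 1ᴿ))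
          ≡⟨ ∑-cong vecs (λ a → trans (∑-*ˡ vecs (𝟙 (A a)) (λ b → iv (dot R a b ≟ 1ᴿ)))
               (trans (cong (𝟙 (A a) *_) (degree a)) (sym (*-assoc (𝟙 (A a)) _ _)))) ⟩
        ∑[ a ∈ vecs ] (𝟙 (A a) * iv (primitive? a) * m ^ suc n)
          ≡⟨ ∑-*ʳ vecs (λ a → 𝟙 (A a) * iv (primitive? a)) (m ^ suc n) ⟩
        ∣A∣ₚ * m ^ suc n ∎
        where open ≡-Reasoning

      ∑-fibre² : ∑[ b ∈ vecs ] (fibre b * fibre b) ≤ m ^ n * (∣A∣ₚ * (∣A∣ₚ + tail N ℓ))
      ∑-fibre² = begin
        ∑[ b ∈ vecs ] (fibre b * fibre b)
          ≡⟨ ∑-cong vecs (λ b → ∑-*-∑ vecs vecs (x b) (x b)) ⟩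
        ∑[ b ∈ vecs ] ∑[ a ∈ vecs ] ∑[ a′ ∈ vecs ] (x b a * x b a′)
          ≡⟨ ∑-swap vecs vecs (λ b a → ∑[ a′ ∈ vecs ] (x b a * x b a′)) ⟩
        ∑[ a ∈ vecs ] ∑[ b ∈ vecs ] ∑[ a′ ∈ vecs ] (x b a * x b a′)
          ≡⟨ ∑-cong vecs (λ a → ∑-swap vecs vecs (λ b a′ → x b a * x b a′)) ⟩
        ∑[ a ∈ vecs ] ∑[ a′ ∈ vecs ] ∑[ b ∈ vecs ] (x b a * x b a′)
          ≡⟨ ∑-cong vecs (λ a → ∑-cong vecs (λ a′ → trans
               (∑-cong vecs (λ b → interchange (𝟙 (A a)) _ (𝟙 (A a′)) _))
               (∑-*ˡ vecs (𝟙 (A a) * 𝟙 (A a′)) (λ b → iv (dot R a b ≟ 1ᴿ) * iv (dot R a′ b ≟ 1ᴿ))))) ⟩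
        ∑[ a ∈ vecs ] ∑[ a′ ∈ vecs ] (𝟙 (A a) * 𝟙 (A a′) * codegree a a′)
          ≤⟨ ∑-mono vecs (λ a → ∑-mono vecs (λ a′ → *-monoʳ-≤ (𝟙 (A a) * 𝟙 (A a′)) (codegree≤ a a′))) ⟩
        ∑[ a ∈ vecs ] ∑[ a′ ∈ vecs ] (𝟙 (A a) * 𝟙 (A a′) * (m ^ n * (iv (primitive? a) * (iv (primitive? a′) * weight ℓ a a′))))
          ≡⟨ ∑-cong vecs (λ a → trans
               (∑-cong vecs (λ a′ → rearrange (𝟙 (A a)) (𝟙 (A a′)) (m ^ n) (iv (primitive? a)) (iv (primitive? a′)) (weight ℓ a a′)))
               (∑-*ˡ vecs (m ^ n * p a) (λ a′ → p a′ * weight ℓ a a′))) ⟩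
        ∑[ a ∈ vecs ] (m ^ n * p a * ∑[ a′ ∈ vecs ] (p a′ * weight ℓ a a′))
          ≤⟨ ∑-mono vecs (λ a → *-monoʳ-≤ (m ^ n * p a) (∑-weight ℓ a p (λ a′ → *-mono-≤ (𝟙≤1 (A a′)) (iv≤1 (primitive? a′))))) ⟩
        ∑[ a ∈ vecs ] (m ^ n * p a * (∣A∣ₚ + tail N ℓ))
          ≡⟨ trans (∑-*ʳ vecs (λ a → m ^ n * p a) (∣A∣ₚ + tail N ℓ))
                   (trans (cong (_* (∣A∣ₚ + tail N ℓ)) (∑-*ˡ vecs (m ^ n) p)) (*-assoc (m ^ n) ∣A∣ₚ _)) ⟩
        m ^ n * (∣A∣ₚ * (∣A∣ₚ + tail N ℓ)) ∎
        where
        open ≤-Reasoning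
        x : Vec (Fin m) N → Vec (Fin m) N → ℕ
        x b a = 𝟙 (A a) * iv (dot R a b ≟ 1ᴿ)
        p : Vec (Fin m) N → ℕ
        p a = 𝟙 (A a) * iv (primitive? a)
        interchange : ∀ a b c d → a * b * (c * d) ≡ a * c * (b * d)
        interchange = solve-∀
        rearrange : ∀ a a′ M i i′ w → a * a′ * (M * (i * (i′ * w))) ≡ M * (a * i) * (a′ * i′ * w)
        rearrange = solve-∀

      deviation : Vec (Fin m) N → ℕ
      deviation b = ∣ m * fibre b - ∣A∣ ∣

      variance : ℕ
      variance = ∑[ b ∈ vecs ] (deviation b * deviation b)

      -- The expanded square, summed over b; its cross term is evaluated exactly by `∑-fibre`.
      variance+cross : variance + 2 * (∣A∣ * (∣A∣ₚ * m ^ N)) ≡ m * m * ∑[ b ∈ vecs ] (fibre b * fibre b) + m ^ N * (∣A∣ * ∣A∣)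
      variance+cross = begin
        variance + 2 * (∣A∣ * (∣A∣ₚ * (m * m ^ suc n)))
          ≡⟨ cong (variance +_) (trans (cross ∣A∣ ∣A∣ₚ m (m ^ suc n)) (cong (2 * (m * ∣A∣) *_) (sym ∑-fibre))) ⟩
        variance + 2 * (m * ∣A∣) * ∑ vecs fibre
          ≡⟨ cong (variance +_) (trans (sym (∑-*ˡ vecs (2 * (m * ∣A∣)) fibre))
                                       (∑-cong vecs (λ b → cross′ m ∣A∣ (fibre b)))) ⟩
        variance + ∑[ b ∈ vecs ] (2 * (m * fibre b * ∣A∣))
          ≡⟨ sym (∑-+ vecs (λ b → deviation b * deviation b) (λ b → 2 * (m * fibre b * ∣A∣))) ⟩
        ∑[ b ∈ vecs ] (deviation b * deviation b + 2 * (m * fibre b * ∣A∣))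
          ≡⟨ ∑-cong vecs (λ b → ∣-∣²+2xy (m * fibre b) ∣A∣) ⟩
        ∑[ b ∈ vecs ] (m * fibre b * (m * fibre b) + ∣A∣ * ∣A∣)
          ≡⟨ ∑-cong vecs (λ b → cong₂ _+_ (square m (fibre b)) (sym (*-identityˡ (∣A∣ * ∣A∣)))) ⟩
        ∑[ b ∈ vecs ] (m * m * (fibre b * fibre b) + 1 * (∣A∣ * ∣A∣))
          ≡⟨ ∑-+ vecs (λ b → m * m * (fibre b * fibre b)) (λ _ → 1 * (∣A∣ * ∣A∣)) ⟩
        ∑[ b ∈ vecs ] (m * m * (fibre b * fibre b)) + ∑[ b ∈ vecs ] (1 * (∣A∣ * ∣A∣))
          ≡⟨ cong₂ _+_ (∑-*ˡ vecs (m * m) (λ b → fibre b * fibre b))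
               (trans (∑-*ʳ vecs (λ _ → 1) (∣A∣ * ∣A∣)) (cong (_* (∣A∣ * ∣A∣)) (∑-1-allVecs {m} N))) ⟩
        m * m * ∑[ b ∈ vecs ] (fibre b * fibre b) + m ^ N * (∣A∣ * ∣A∣) ∎
        where
        open ≡-Reasoning
        cross : ∀ c α m M → 2 * (c * (α * (m * M))) ≡ 2 * (m * c) * (α * M)
        cross = solve-∀
        cross′ : ∀ m c f → 2 * (m * c) * f ≡ 2 * (m * f * c)
        cross′ = solve-∀
        square : ∀ m f → m * f * (m * f) ≡ m * m * (f * f)
        square = solve-∀

      variance≤ : variance ≤ m ^ N * (∣A∣ₙ * ∣A∣ₙ + ∣A∣ₚ * tail N ℓ)
      variance≤ = +-cancelʳ-≤ (2 * (∣A∣ * (∣A∣ₚ * m ^ N))) _ _ (begin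
        variance + 2 * (∣A∣ * (∣A∣ₚ * m ^ N))
          ≡⟨ variance+cross ⟩
        m * m * ∑[ b ∈ vecs ] (fibre b * fibre b) + m ^ N * (∣A∣ * ∣A∣)
          ≤⟨ +-monoˡ-≤ (m ^ N * (∣A∣ * ∣A∣)) (*-monoʳ-≤ (m * m) ∑-fibre²) ⟩
        m * m * (m ^ n * (∣A∣ₚ * (∣A∣ₚ + tail N ℓ))) + m ^ N * (∣A∣ * ∣A∣)
          ≡⟨ cong (λ c → m * m * (m ^ n * (∣A∣ₚ * (∣A∣ₚ + tail N ℓ))) + m ^ N * (c * c)) ∣A∣-split ⟩
        m * m * (m ^ n * (∣A∣ₚ * (∣A∣ₚ + tail N ℓ))) + m ^ N * ((∣A∣ₚ + ∣A∣ₙ) * (∣A∣ₚ + ∣A∣ₙ))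
          -- With |A| = α + z the α² terms cancel against the cross term, leaving z² + αT.
          ≡⟨ complete m (m ^ n) ∣A∣ₚ ∣A∣ₙ (tail N ℓ) ⟩
        m ^ N * (∣A∣ₙ * ∣A∣ₙ + ∣A∣ₚ * tail N ℓ) + 2 * ((∣A∣ₚ + ∣A∣ₙ) * (∣A∣ₚ * m ^ N))
          ≡⟨ cong (λ c → m ^ N * (∣A∣ₙ * ∣A∣ₙ + ∣A∣ₚ * tail N ℓ) + 2 * (c * (∣A∣ₚ * m ^ N))) (sym ∣A∣-split) ⟩
        m ^ N * (∣A∣ₙ * ∣A∣ₙ + ∣A∣ₚ * tail N ℓ) + 2 * (∣A∣ * (∣A∣ₚ * m ^ N)) ∎)
        where
        open ≤-Reasoning
        complete : ∀ m M α z T →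
          m * m * (M * (α * (α + T))) + m * (m * M) * ((α + z) * (α + z))
          ≡ m * (m * M) * (z * z + α * T) + 2 * ((α + z) * (α * (m * (m * M))))
        complete = solve-∀

      variance< : ∀ {L} → suc L ≡ ℓ → 0 < ∣A∣ → variance < m ^ N * (q ^ suc (L * N) * ∣A∣)
      variance< {L} ℓ≡ A>0 = ≤-<-trans variance≤ (*-monoʳ-< (m ^ N) {{m^n≢0 m N {{m≢0}}}}
        (subst (λ c → ∣A∣ₙ * ∣A∣ₙ + ∣A∣ₚ * tail N ℓ < q ^ suc (L * N) * c) (sym ∣A∣-split)
          (combination< ∣A∣ₚ ∣A∣ₙ ∣A∣ₙ< (tail< ℓ≡ (s≤s (s≤s z≤n))) (subst (0 <_) ∣A∣-split A>0))))
        where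
        B = q ^ suc (L * N)
        instance
          q≢0 : NonZero q
          q≢0 = >-nonZero (<-trans (s≤s z≤n) q>1)
        m≢0 : NonZero m
        m≢0 = subst NonZero (sym m≡q^ℓ) (m^n≢0 q ℓ)
        ∣A∣ₙ< : ∣A∣ₙ < B
        ∣A∣ₙ< = begin-strict
          ∣A∣ₙ                                    ≤⟨ ∑-mono vecs (λ a → ≤-trans (*-monoˡ-≤ _ (𝟙≤1 (A a))) (≤-reflexive (*-identityˡ _))) ⟩
          ∑[ a ∈ vecs ] iv (nonPrimitive? a)      ≤⟨ nonPrimitive-size N ⟩
          idealSize 1 ^ N                         ≡⟨ trans (cong (_^ N) (idealSize≡q^ L 1 ℓ≡)) (^-*-assoc q L N) ⟩
          q ^ (L * N)                             <⟨ ^-monoʳ-< q q>1 (n<1+n (L * N)) ⟩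
          B                                       ∎
          where open ≤-Reasoning

      error²≤∣B∣*variance : ∀ (B : Vec (Fin m) N → Bool) →
        let β = ∑[ b ∈ vecs ] 𝟙 (B b)
            E = ∣ m * ∑[ b ∈ vecs ] (𝟙 (B b) * fibre b) - ∣A∣ * β ∣
        in E * E ≤ β * variance
      error²≤∣B∣*variance B = begin
        E * E                                                              ≤⟨ *-mono-≤ E≤ E≤ ⟩
        S * S                                                              ≤⟨ cauchySchwarz (𝟙 ∘ B) deviation vecs ⟩
        β * ∑[ b ∈ vecs ] (𝟙 (B b) * (deviation b * deviation b))
          ≤⟨ *-monoʳ-≤ β (∑-mono vecs (λ b → ≤-trans (*-monoˡ-≤ _ (𝟙≤1 (B b))) (≤-reflexive (*-identityˡ _)))) ⟩
        β * variance                                                       ∎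
        where
        open ≤-Reasoning
        β = ∑[ b ∈ vecs ] 𝟙 (B b)
        E = ∣ m * ∑[ b ∈ vecs ] (𝟙 (B b) * fibre b) - ∣A∣ * β ∣
        S = ∑[ b ∈ vecs ] (𝟙 (B b) * deviation b)
        swap : ∀ a b c → a * (b * c) ≡ b * (a * c)
        swap = solve-∀
        E≤ : E ≤ S
        E≤ = begin
          E
            ≡⟨ cong₂ ∣_-_∣
                 (trans (sym (∑-*ˡ vecs m (λ b → 𝟙 (B b) * fibre b))) (∑-cong vecs (λ b → swap m (𝟙 (B b)) (fibre b))))
                 (trans (*-comm ∣A∣ β) (sym (∑-*ʳ vecs (λ b → 𝟙 (B b)) ∣A∣))) ⟩
          ∣ ∑[ b ∈ vecs ] (𝟙 (B b) * (m * fibre b)) - ∑[ b ∈ vecs ] (𝟙 (B b) * ∣A∣) ∣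
            ≤⟨ ∑-∣-∣ vecs (λ b → 𝟙 (B b) * (m * fibre b)) (λ b → 𝟙 (B b) * ∣A∣) ⟩
          ∑[ b ∈ vecs ] ∣ 𝟙 (B b) * (m * fibre b) - 𝟙 (B b) * ∣A∣ ∣
            ≡⟨ ∑-cong vecs (λ b → sym (*-distribˡ-∣-∣ (𝟙 (B b)) (m * fibre b) ∣A∣)) ⟩
          S ∎

-- From counts to sums, and the theorem.

card≡∑ : ∀ {m n} (A : Vec (Fin m) n → Bool) → card A ≡ ∑[ a ∈ allVecs n ] 𝟙 (A a)
card≡∑ {n = n} A = count≡∑ A (allVecs n)

card>0 : ∀ {m n} (A : Vec (Fin m) n → Bool) → NonEmpty A → 0 < ∑[ a ∈ allVecs n ] 𝟙 (A a)
card>0 A (a , a∈A) = ≤-trans (≤-reflexive (cong 𝟙 (sym a∈A))) (≤∑-allVecs a (𝟙 ∘ A))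

N₁≡∑ : ∀ {m n} (R : FinCommRing m) (A B : Vec (Fin m) n → Bool) →
  N₁ R A B ≡ ∑[ b ∈ allVecs n ] (𝟙 (B b) * ∑[ a ∈ allVecs n ] (𝟙 (A a) * iv (dot R a b ≟ FinCommRing.1ᴿ R)))
N₁≡∑ {n = n} R A B = begin
  N₁ R A B
    ≡⟨ trans (count≡∑ _ (cartesianProduct vecs vecs)) (∑-cartesianProduct vecs vecs _) ⟩
  ∑[ a ∈ vecs ] ∑[ b ∈ vecs ] 𝟙 (A a ∧ B b ∧ ⌊ dot R a b ≟ 1ᴿ ⌋)
    ≡⟨ ∑-cong vecs (λ a → ∑-cong vecs (λ b → trans (𝟙-∧ (A a) _) (trans
         (cong (𝟙 (A a) *_) (trans (𝟙-∧ (B b) _) (cong (𝟙 (B b) *_) (𝟙⌊⌋ (dot R a b ≟ 1ᴿ)))))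
         (swap (𝟙 (A a)) (𝟙 (B b)) _)))) ⟩
  ∑[ a ∈ vecs ] ∑[ b ∈ vecs ] (𝟙 (B b) * (𝟙 (A a) * iv (dot R a b ≟ 1ᴿ)))
    ≡⟨ ∑-swap vecs vecs (λ a b → 𝟙 (B b) * (𝟙 (A a) * iv (dot R a b ≟ 1ᴿ))) ⟩
  ∑[ b ∈ vecs ] ∑[ a ∈ vecs ] (𝟙 (B b) * (𝟙 (A a) * iv (dot R a b ≟ 1ᴿ)))
    ≡⟨ ∑-cong vecs (λ b → ∑-*ˡ vecs (𝟙 (B b)) (λ a → 𝟙 (A a) * iv (dot R a b ≟ 1ᴿ))) ⟩
  ∑[ b ∈ vecs ] (𝟙 (B b) * ∑[ a ∈ vecs ] (𝟙 (A a) * iv (dot R a b ≟ 1ᴿ))) ∎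
  where
  open ≡-Reasoning
  open FinCommRing R using (1ᴿ)
  vecs = allVecs n
  swap : ∀ a b c → a * (b * c) ≡ b * (a * c)
  swap = solve-∀

N₁>0⇒∃ : ∀ {m n} (R : FinCommRing m) (A B : Vec (Fin m) n → Bool) → 0 < N₁ R A B →
  ∃ λ a → ∃ λ b → A a ≡ true × B b ≡ true × dot R a b ≡ FinCommRing.1ᴿ R
N₁>0⇒∃ {n = n} R A B N>0
  with b , hit ← ∑-pos (allVecs n) (λ b → 𝟙 (B b) * _) (subst (0 <_) (N₁≡∑ R A B) N>0)
  with B b in b∈B
... | true
  with a , hit′ ← ∑-pos (allVecs n) (λ a → 𝟙 (A a) * iv (dot R a b ≟ FinCommRing.1ᴿ R)) (subst (0 <_) (*-identityˡ _) hit)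
  with A a in a∈A | dot R a b ≟ FinCommRing.1ᴿ R
...   | true | yes eq = a , b , a∈A , b∈B , eq

theorem1p10 : (m : ℕ) (R : FinCommRing m) → IsLocal R → IsPrincipalRing R →
    (π : Fin m) → IsMaximalIdeal R (⟨_⟩ R π) →
    (q ℓ : ℕ) → ResidueCard R π q → NilDegree R π ℓ → q % 2 ≡ 1 →
    (n : ℕ) → 2 ≤ n →
    (A B : Vec (Fin m) n → Bool) → NonEmpty A → NonEmpty B →
    (∣ q ^ ℓ * N₁ R A B - card A * card B ∣ ^ 2
    < q ^ ((n ∸ 1) * (2 * ℓ ∸ 1) + 2 * ℓ) * (card A * card B))
    × (m ^ (2 * n) ≤ card A * card B * q ^ (n ∸ 1) →
    ∃ λ a → ∃ λ b → A a ≡ true × B b ≡ true × dot R a b ≡ FinCommRing.1ᴿ R)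
theorem1p10 m R _ _ π maximal q (suc L) residue nil _ (suc (suc n)) (s≤s (s≤s z≤n)) A B A≠∅ B≠∅ = bound , incidence
  where
  open FiniteRing.ValuationRing R π maximal q (suc L) residue nil
  open Variance A

  ℓ : ℕ
  ℓ = suc L

  X : ℕ
  X = card A * card B

  e : ℕ
  e = (N ∸ 1) * (2 * ℓ ∸ 1) + 2 * ℓ

  instance
    cardB≢0 : NonZero (card B)
    cardB≢0 = >-nonZero (subst (0 <_) (sym (card≡∑ B)) (card>0 B B≠∅))
    q≢0 : NonZero q
    q≢0 = >-nonZero (<-trans (s≤s z≤n) q>1)
    q^≢0 : NonZero (q ^ suc n)
    q^≢0 = m^n≢0 q (suc n)

  bound : ∣ q ^ ℓ * N₁ R A B - card A * card B ∣ ^ 2 < q ^ e * (card A * card B)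
  bound = begin-strict
    ∣ q ^ ℓ * N₁ R A B - card A * card B ∣ ^ 2
      ≡⟨ cong (∣ q ^ ℓ * N₁ R A B - card A * card B ∣ *_) (*-identityʳ _) ⟩
    ∣ q ^ ℓ * N₁ R A B - card A * card B ∣ * ∣ q ^ ℓ * N₁ R A B - card A * card B ∣
      ≡⟨ cong (λ E → E * E) (cong₂ ∣_-_∣ (cong₂ _*_ (sym m≡q^ℓ) (N₁≡∑ R A B)) (cong₂ _*_ (card≡∑ A) (card≡∑ B))) ⟩
    _ ≤⟨ error²≤∣B∣*variance B ⟩
    ∑[ b ∈ vecs ] 𝟙 (B b) * variance
      ≡⟨ cong (_* variance) (sym (card≡∑ B)) ⟩
    card B * variance
      -- Strictness survives the factor |B| since B is inhabited; that A is inhabited is used inside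
      -- `variance<`.
      <⟨ *-monoʳ-< (card B) (variance< refl (card>0 A A≠∅)) ⟩
    card B * (m ^ N * (q ^ suc (L * N) * ∣A∣))
      ≡⟨ cong (λ c → card B * (m ^ N * (q ^ suc (L * N) * c))) (sym (card≡∑ A)) ⟩
    card B * (m ^ N * (q ^ suc (L * N) * card A))
      ≡⟨ rearrange (card B) (m ^ N) (q ^ suc (L * N)) (card A) ⟩
    m ^ N * q ^ suc (L * N) * X
      ≡⟨ cong (_* X) (trans (cong (_* q ^ suc (L * N)) (trans (cong (_^ N) m≡q^ℓ) (^-*-assoc q ℓ N)))
                            (sym (^-distribˡ-+-* q (ℓ * N) (suc (L * N))))) ⟩
    q ^ (ℓ * N + suc (L * N)) * X
      -- Both exponents equal (2ℓ - 1) N + 1.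
      ≡⟨ cong (λ d → q ^ d * X) (exponent L n) ⟩
    q ^ e * X ∎
    where
    open ≤-Reasoning
    rearrange : ∀ b M K a → b * (M * (K * a)) ≡ M * K * (a * b)
    rearrange = solve-∀
    exponent : ∀ L n → suc L * suc (suc n) + suc (L * suc (suc n)) ≡ suc n * (L + suc (L + 0)) + 2 * suc L
    exponent = solve-∀

  incidence : m ^ (2 * N) ≤ X * q ^ suc n → ∃ λ a → ∃ λ b → A a ≡ true × B b ≡ true × dot R a b ≡ FinCommRing.1ᴿ R
  incidence dense with N₁ R A B in N₁≡
  ... | suc _ = N₁>0⇒∃ R A B (subst (0 <_) (sym N₁≡) (s≤s z≤n))
  -- With N₁ = 0 the error is X itself, so the bound reads X² < q^e X. Then X < q^e, and e + (N - 1)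
  -- = 2ℓN contradicts the density assumption.
  ... | zero  = ⊥-elim (<-irrefl refl (begin-strict
    m ^ (2 * N)          ≤⟨ dense ⟩
    X * q ^ suc n        <⟨ *-monoˡ-< (q ^ suc n) X<q^e ⟩
    q ^ e * q ^ suc n    ≡⟨ sym (^-distribˡ-+-* q e (suc n)) ⟩
    q ^ (e + suc n)      ≡⟨ cong (q ^_) (exponent L n) ⟩
    q ^ (ℓ * (2 * N))    ≡⟨ sym (^-*-assoc q ℓ (2 * N)) ⟩
    (q ^ ℓ) ^ (2 * N)    ≡⟨ cong (_^ (2 * N)) (sym m≡q^ℓ) ⟩
    m ^ (2 * N)          ∎))
    where
    open ≤-Reasoning
    exponent : ∀ L n → suc n * (L + suc (L + 0)) + 2 * suc L + suc n ≡ suc L * (2 * suc (suc n))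
    exponent = solve-∀
    X<q^e : X < q ^ e
    X<q^e = *-cancelʳ-< X X (q ^ e) (begin-strict
      X * X                                ≡⟨ cong (X *_) (sym (*-identityʳ X)) ⟩
      X ^ 2                                ≡⟨ cong (λ d → ∣ d - X ∣ ^ 2) (sym (trans (cong (q ^ ℓ *_) N₁≡) (*-zeroʳ (q ^ ℓ)))) ⟩
      ∣ q ^ ℓ * N₁ R A B - X ∣ ^ 2         <⟨ bound ⟩
      q ^ e * X                            ∎)
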